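{- Let $>$ be a ground-total reduction order and let $\Gamma\colon(\mathcal{E}_0,\mathcal{R}_0)\vdash_{\mathsf o}(\mathcal{E}_1,\mathcal{R}_1)\vdash_{\mathsf o}(\mathcal{E}_2,\mathcal{R}_2)\vdash_{\mathsf o}\cdots$ be an infinite run of ordered completion $\mathsf{KB_o}$ with respect to $>$, with $\mathcal{R}_0=\varnothing$. If $\Gamma$ is fair and $\mathcal{E}_\omega=\varnothing$ then $\mathcal{R}_\omega$ is a complete presentation of $\mathcal{E}_0$.
   Context: Terms are built from a signature $\mathcal{F}$ and an infinite set of variables. An ES is a set of pairs of terms $s\approx t$; a TRS is a set of pairs $\ell\to r$ with $\ell$ not a variable and every variable of $r$ occurring in $\ell$. For a set $X$ of pairs of terms, $X^{\pm}=X\cup X^{ -1}$, $\to_X$ is the closure of $X$ under contexts and substitutions, $\leftrightarrow_X$ its symmetric closure, $\leftrightarrow_X^*$ the conversion relation, and $\downarrow_X\,=\,\to_X^*\cdot{}_X^*{\leftarrow}$ joinability. A reduction order is a well-founded strict order on terms closed under contexts and substitutions; it is ground-total if any two distinct ground terms are comparable. A TRS is complete if it is terminating and confluent (on all terms); $\mathcal{R}$ is a complete presentation of $\mathcal{E}$ if $\mathcal{R}$ is complete and $\leftrightarrow_{\mathcal{R}}^*\,=\,\leftrightarrow_{\mathcal{E}}^*$. For an ES $\mathcal{E}$, $\mathcal{E}^>$ is the set of rules $\ell\sigma\to r\sigma$ with $\ell\approx r\in\mathcal{E}^\pm$, $\sigma$ a substitution, and $\ell\sigma>r\sigma$. A term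 $s$ encompasses $t$ if $s=C[t\sigma]$ for some $C,\sigma$; properly, if moreover $t$ does not encompass $s$. Write $t\to^{\rhd}_{\mathcal{R}}u$ if $t\to u$ using a rule $\ell\to r\in\mathcal{R}$ with $t$ properly encompassing $\ell$, and $t\to^{\rhd}_{\mathcal{E}^>}u$ if there are $\ell\approx r\in\mathcal{E}^\pm$, $C$, $\sigma$ with $t=C[\ell\sigma]$, $u=C[r\sigma]$, $\ell\sigma>r\sigma$, and $t$ properly encompasses $\ell$. Inference system $\mathsf{KB_o}$ ($\uplus$ is disjoint union): $(\mathcal{E},\mathcal{R})\vdash_{\mathsf o}(\mathcal{E}',\mathcal{R}')$ if it is an instance of one of - deduce: $(\mathcal{E},\mathcal{R})\vdash(\mathcal{E}\cup\{s\approx t\},\mathcal{R})$ if $s\,{}_{\mathcal{R}\cup\mathcal{E}^\pm}{\leftarrow}\cdot\to_{\mathcal{R}\cup\mathcal{E}^\pm}t$; - orient: $(\mathcal{E}\uplus\{s\approx t\},\mathcal{R})\vdash(\mathcal{E},\mathcal{R}\cup\{s\to t\})$ if $s>t$, and $(\mathcal{E}\uplus\{s\approx t\},\mathcal{R})\vdash(\mathcal{E},\mathcal{R}\cup\{t\to s\})$ if $t>s$; - delete: $(\mathcal{E}\uplus\{s\approx s\},\mathcal{R})\vdash(\mathcal{E},\mathcal{R})$; - compose: $(\mathcal{E},\mathcal{R}\uplus\{s\to t\})\vdash(\mathcal{E},\mathcal{R}\cup\{s\to u\})$ if $t\to_{\mathcal{E}^>\cup\mathcal{R}}u$; - simplify: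 $(\mathcal{E}\uplus\{s\approx t\},\mathcal{R})\vdash(\mathcal{E}\cup\{u\approx t\},\mathcal{R})$ if $s\to_{\mathcal{R}}u$ or $s\to^{\rhd}_{\mathcal{E}^>}u$, and $(\mathcal{E}\uplus\{s\approx t\},\mathcal{R})\vdash(\mathcal{E}\cup\{s\approx u\},\mathcal{R})$ if $t\to_{\mathcal{R}}u$ or $t\to^{\rhd}_{\mathcal{E}^>}u$; - collapse: $(\mathcal{E},\mathcal{R}\uplus\{t\to s\})\vdash(\mathcal{E}\cup\{u\approx s\},\mathcal{R})$ if $t\to^{\rhd}_{\mathcal{R}}u$ or $t\to^{\rhd}_{\mathcal{E}^>}u$. For an infinite run put $\mathcal{E}_\infty=\bigcup_{i}\mathcal{E}_i$, $\mathcal{E}_\omega=\bigcup_{i}\bigcap_{j\ge i}\mathcal{E}_j$, $\mathcal{R}_\omega=\bigcup_{i}\bigcap_{j\ge i}\mathcal{R}_j$, $\mathcal{S}_\omega=\mathcal{E}_\omega^>\cup\mathcal{R}_\omega$. Extended prime critical pairs: an extended overlap of an ES $\mathcal{E}$ is a triple $\langle\ell_1\approx r_1,p,\ell_2\approx r_2\rangle$ where both equations are variants (up to renaming) of equations in $\mathcal{E}^\pm$ without common variables, $p$ is a non-variable position of $\ell_2$, $\ell_1$ and $\ell_2|_p$ are unifiable with mgu $\mu$, $r_1\mu\not>\ell_1\mu$ and $r_2\mu\not>\ell_2\mu$. It gives the extended critical pair $\ell_2[r_1]_p\mu\approx r_2\mu$, which is prime if all proper subterms of $\ell_1\mu$ are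 $\mathcal{E}^>$-normal forms. $\mathrm{PCP}_>(\mathcal{E})$ is the set of extended prime critical pairs of $\mathcal{E}$ (rules of $\mathcal{R}_\omega$ are viewed as equations in $\mathcal{E}_\omega\cup\mathcal{R}_\omega$). The run is fair if $\mathrm{PCP}_>(\mathcal{E}_\omega\cup\mathcal{R}_\omega)\subseteq{\downarrow_{\mathcal{S}_\omega}}\cup{\leftrightarrow_{\mathcal{E}_\infty}}$. -}

module Defs where

open import Level using (0ℓ)
open import Data.Nat.Base using (ℕ; zero; suc; _≤_)
open import Data.Fin.Base using (Fin)
open import Data.Vec.Base as Vec using (Vec; []; _∷_)
open import Data.Vec.Relation.Unary.Any using (Any)
open import Data.List.Base using (List)
import Data.List.Membership.Propositional as List
open import Data.Product.Base using (_×_; _,_; ∃; ∃-syntax)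
open import Data.Sum.Base using (_⊎_)
open import Function.Base using (flip; _∘_)
open import Function.Bundles using (_↔_; Inverse)
open import Induction.WellFounded using (WellFounded)
open import Relation.Binary.Core using (Rel; _⇒_; _⇔_)
open import Relation.Binary.Structures using (IsStrictPartialOrder)
open import Relation.Binary.Construct.Union using (_∪_)
open import Relation.Binary.Construct.Closure.Symmetric using (SymClosure)
open import Relation.Binary.Construct.Closure.ReflexiveTransitive using (Star)
open import Relation.Binary.Construct.Closure.Equivalence using (EqClosure)
open import Relation.Binary.Rewriting
  using (IsNormalForm; StronglyNormalizing; Confluent)
open import Relation.Binary.PropositionalEquality.Core using (_≡_; _≢_)
open import Relation.Nullary.Negation.Core using (¬_)

record Signature : Set₁ where
  field
    Symbol : Set
    arity  : Symbol → ℕ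

-- No finite list exhausts A.
Infinite : Set → Set
Infinite A = (xs : List A) → ∃[ x ] ¬ (x List.∈ xs)

module Rewriting (𝓕 : Signature) (V : Set) where

  open Signature 𝓕

  data Term : Set where
    var : V → Term
    fun : (f : Symbol) → Vec Term (arity f) → Term

  data IsVar : Term → Set where
    var : ∀ x → IsVar (var x)

  infix 4 _∈ᵛ_

  data _∈ᵛ_ (x : V) : Term → Set where
    var : x ∈ᵛ var x
    fun : ∀ {f ts} → Any (x ∈ᵛ_) ts → x ∈ᵛ fun f ts

  Ground : Term → Set
  Ground t = ∀ x → ¬ (x ∈ᵛ t)

  -- Finiteness of the domain is not required: only the finitely many variables
  -- of the terms at hand matter wherever a substitution is used.
  Subst : Set
  Subst = V → Term

  infixl 8 _·_ _·*_

  _·_  : Term → Subst → Term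
  _·*_ : ∀ {n} → Vec Term n → Subst → Vec Term n

  var x    · σ = σ x
  fun f ts · σ = fun f (ts ·* σ)

  []       ·* σ = []
  (t ∷ ts) ·* σ = (t · σ) ∷ (ts ·* σ)

  -- Terms with exactly one hole; Context* n is an argument vector of length n
  -- in which exactly one argument contains the hole.
  data Context  : Set
  data Context* : ℕ → Set

  data Context where
    □   : Context
    fun : (f : Symbol) → Context* (arity f) → Context

  data Context* where
    here  : ∀ {n} → Context → Vec Term n → Context* (suc n)
    there : ∀ {n} → Term → Context* n → Context* (suc n)

  infix 9 _⟦_⟧ _⟦_⟧*

  _⟦_⟧  : Context → Term → Term
  _⟦_⟧* : ∀ {n} → Context* n → Term → Vec Term n

  □        ⟦ t ⟧ = t
  fun f Cs ⟦ t ⟧ = fun f (Cs ⟦ t ⟧*)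

  here C ts  ⟦ t ⟧* = C ⟦ t ⟧ ∷ ts
  there s Cs ⟦ t ⟧* = s ∷ Cs ⟦ t ⟧*

  data Pos : Term → Set where
    ε   : ∀ {t} → Pos t
    _∷_ : ∀ {f ts} (i : Fin (arity f)) → Pos (Vec.lookup ts i) → Pos (fun f ts)

  infix 9 _∣_ _[_]≔_

  _∣_ : (t : Term) → Pos t → Term
  t        ∣ ε       = t
  fun f ts ∣ (i ∷ p) = Vec.lookup ts i ∣ p

  _[_]≔_ : (t : Term) → Pos t → Term → Term
  t        [ ε     ]≔ u = u
  fun f ts [ i ∷ p ]≔ u = fun f (ts Vec.[ i ]≔ (Vec.lookup ts i [ p ]≔ u))

  -- A set of pairs of terms.  Such sets are compared by mutual inclusion _⇔_.
  ES : Set₁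
  ES = Rel Term 0ℓ

  ｛_≈_｝ : Term → Term → ES
  ｛ s ≈ t ｝ a b = a ≡ s × b ≡ t

  infix 9 _±

  _± : ES → ES
  X ± = X ∪ flip X

  IsTRS : ES → Set
  IsTRS X = ∀ {l r} → X l r → ¬ IsVar l × (∀ x → x ∈ᵛ r → x ∈ᵛ l)

  data Step (X : ES) : Rel Term 0ℓ where
    step : ∀ {l r} → X l r → (C : Context) (σ : Subst) →
           Step X (C ⟦ l · σ ⟧) (C ⟦ r · σ ⟧)

  Conversion : ES → Rel Term 0ℓ
  Conversion X = EqClosure (Step X)

  Joinable : ES → Rel Term 0ℓ
  Joinable X s t = ∃[ u ] Star (Step X) s u × Star (Step X) t u

  record IsComplete (X : ES) : Set where
    field
      isTRS       : IsTRS X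
      terminating : StronglyNormalizing (Step X)
      confluent   : Confluent (Step X)

  record IsCompletePresentation (R E : ES) : Set where
    field
      complete       : IsComplete R
      sameConversion : Conversion R ⇔ Conversion E

  Encompasses : Rel Term 0ℓ
  Encompasses s t = ∃[ C ] ∃[ σ ] s ≡ C ⟦ t · σ ⟧

  ProperlyEncompasses : Rel Term 0ℓ
  ProperlyEncompasses s t = Encompasses s t × ¬ Encompasses t s

  record IsReductionOrder (_>_ : Rel Term 0ℓ) : Set where
    field
      isStrictPartialOrder : IsStrictPartialOrder _≡_ _>_
      wellFounded          : WellFounded (flip _>_)
      closedContext        : ∀ {s t} (C : Context) → s > t → (C ⟦ s ⟧) > (C ⟦ t ⟧)
      closedSubst          : ∀ {s t} (σ : Subst) → s > t → (s · σ) > (t · σ)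

  GroundTotal : Rel Term 0ℓ → Set
  GroundTotal _>_ = ∀ s t → Ground s → Ground t → s ≢ t → s > t ⊎ t > s

  -- Renamings are permutations of the variables.
  rename : V ↔ V → Subst
  rename π = var ∘ Inverse.to π

  IsVariant : (l r l′ r′ : Term) → Set
  IsVariant l r l′ r′ = ∃[ π ] l ≡ l′ · rename π × r ≡ r′ · rename π

  VariantIn : ES → Rel Term 0ℓ
  VariantIn X l r = ∃[ l′ ] ∃[ r′ ] X l′ r′ × IsVariant l r l′ r′

  Unifies : Subst → Rel Term 0ℓ
  Unifies σ s t = s · σ ≡ t · σ

  IsMGU : Subst → Rel Term 0ℓ
  IsMGU μ s t =
    Unifies μ s t × (∀ τ → Unifies τ s t → ∃[ δ ] ∀ x → τ x ≡ μ x · δ)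

  module OrderedCompletion (_>_ : Rel Term 0ℓ) where

    infix 9 _^>

    _^> : ES → ES
    (E ^>) s t =
      ∃[ l ] ∃[ r ] ∃[ σ ] (E ±) l r × s ≡ l · σ × t ≡ r · σ × (l · σ) > (r · σ)

    data StepR▷ (R : ES) : Rel Term 0ℓ where
      step : ∀ {l r} → R l r → (C : Context) (σ : Subst) →
             ProperlyEncompasses (C ⟦ l · σ ⟧) l →
             StepR▷ R (C ⟦ l · σ ⟧) (C ⟦ r · σ ⟧)

    -- The encompassment condition concerns the equation l ≈ r itself, not its
    -- instance in E ^>, so this is not StepR▷ (E ^>).
    data StepE▷ (E : ES) : Rel Term 0ℓ where
      step : ∀ {l r} → (E ±) l r → (C : Context) (σ : Subst) →
             (l · σ) > (r · σ) →
             ProperlyEncompasses (C ⟦ l · σ ⟧) l →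
             StepE▷ E (C ⟦ l · σ ⟧) (C ⟦ r · σ ⟧)

    infix 4 _⊢ʳ_ _⊢_

    -- A premise ¬ E s t (or ¬ R s t) makes the union on the left-hand side of
    -- the same rule disjoint.
    data _⊢ʳ_ : ES × ES → ES × ES → Set₁ where
      deduce    : ∀ {E R s t u} →
                  Step (R ∪ E ±) u s → Step (R ∪ E ±) u t →
                  (E , R) ⊢ʳ (E ∪ ｛ s ≈ t ｝ , R)
      orientˡ   : ∀ {E R s t} → ¬ E s t → s > t →
                  (E ∪ ｛ s ≈ t ｝ , R) ⊢ʳ (E , R ∪ ｛ s ≈ t ｝)
      orientʳ   : ∀ {E R s t} → ¬ E s t → t > s →
                  (E ∪ ｛ s ≈ t ｝ , R) ⊢ʳ (E , R ∪ ｛ t ≈ s ｝)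
      delete    : ∀ {E R s} → ¬ E s s →
                  (E ∪ ｛ s ≈ s ｝ , R) ⊢ʳ (E , R)
      compose   : ∀ {E R s t u} → ¬ R s t → Step (E ^> ∪ R) t u →
                  (E , R ∪ ｛ s ≈ t ｝) ⊢ʳ (E , R ∪ ｛ s ≈ u ｝)
      simplifyˡ : ∀ {E R s t u} → ¬ E s t → Step R s u ⊎ StepE▷ E s u →
                  (E ∪ ｛ s ≈ t ｝ , R) ⊢ʳ (E ∪ ｛ u ≈ t ｝ , R)
      simplifyʳ : ∀ {E R s t u} → ¬ E s t → Step R t u ⊎ StepE▷ E t u →
                  (E ∪ ｛ s ≈ t ｝ , R) ⊢ʳ (E ∪ ｛ s ≈ u ｝ , R)
      collapse  : ∀ {E R s t u} → ¬ R t s → StepR▷ R t u ⊎ StepE▷ E t u →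
                  (E , R ∪ ｛ t ≈ s ｝) ⊢ʳ (E ∪ ｛ u ≈ s ｝ , R)

    -- Closing the rules under _⇔_ makes them rules on sets of pairs rather
    -- than on particular relations presenting these sets.
    _⊢_ : ES × ES → ES × ES → Set₁
    (E , R) ⊢ (E′ , R′) =
      ∃[ E₁ ] ∃[ R₁ ] ∃[ E₂ ] ∃[ R₂ ]
        (E ⇔ E₁) × (R ⇔ R₁) × ((E₁ , R₁) ⊢ʳ (E₂ , R₂)) × (E₂ ⇔ E′) × (R₂ ⇔ R′)

    record ExtendedOverlap (E : ES) (l₁ r₁ l₂ r₂ : Term) (p : Pos l₂)
                           (μ : Subst) : Set where
      field
        variant₁ : VariantIn (E ±) l₁ r₁
        variant₂ : VariantIn (E ±) l₂ r₂
        disjoint : ∀ x → x ∈ᵛ l₁ ⊎ x ∈ᵛ r₁ → ¬ (x ∈ᵛ l₂ ⊎ x ∈ᵛ r₂)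
        nonVar   : ¬ IsVar (l₂ ∣ p)
        mgu      : IsMGU μ l₁ (l₂ ∣ p)
        r₁≯l₁    : ¬ ((r₁ · μ) > (l₁ · μ))
        r₂≯l₂    : ¬ ((r₂ · μ) > (l₂ · μ))

    IsPrime : ES → Term → Set
    IsPrime E t = (q : Pos t) → q ≢ ε → IsNormalForm (Step (E ^>)) (t ∣ q)

    data PCP (E : ES) : Rel Term 0ℓ where
      pcp : ∀ {l₁ r₁ l₂ r₂ p μ} →
            ExtendedOverlap E l₁ r₁ l₂ r₂ p μ →
            IsPrime E (l₁ · μ) →
            PCP E ((l₂ [ p ]≔ r₁) · μ) (r₂ · μ)

    _∞ : (ℕ → ES) → ES
    (X ∞) s t = ∃[ i ] X i s t

    _ω : (ℕ → ES) → ES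
    (X ω) s t = ∃[ i ] ∀ j → i ≤ j → X j s t

    Fair : (E R : ℕ → ES) → Set
    Fair E R =
      PCP (E ω ∪ R ω) ⇒ Joinable ((E ω) ^> ∪ R ω) ∪ SymClosure (Step (E ∞))

{-# OPTIONS --safe #-}

-- Conversions.  For a set P of terms closed under >, every E∞-step between
-- terms of P is an Rω-conversion inside P.  Rules and equations that do not
-- persist are replaced by the steps that made them disappear; for a step from
-- a larger term s this is an induction on s by >, then on the left-hand side by
-- proper encompassment, then on rules before equations, then on the right-hand
-- side by >, and an unorientable step is an induction on both of its terms.
--
-- Confluence.  It suffices that every peak t ← s → u of Rω is connected by a
-- conversion of terms below s.  Comparing both steps with an innermost step
-- s → v, one may assume that one of them is innermost.  Then the peak is
-- joinable or an instance of a prime critical pair, which by fairness is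
-- joinable or an E∞-step; the latter is handled by the previous paragraph with
-- P the terms below s.

module Submission where

open import Defs
open import Level using (0ℓ)
open import Axiom.ExcludedMiddle using (ExcludedMiddle)
open import Data.Fin.Base using (zero; suc)
open import Data.List.Base using (List; []; _∷_; _++_; map)
open import Data.List.Membership.Propositional using (_∈_)
open import Data.List.Membership.Propositional.Properties using (∈-++⁺ˡ; ∈-++⁺ʳ; ∈-map⁺; ∈-map⁻)
open import Data.List.Properties using (map-++)
open import Data.List.Relation.Unary.All as All using (All; []; _∷_)
import Data.List.Relation.Unary.All.Properties as All
open import Data.List.Relation.Unary.Any using (here; there)
open import Data.Nat.Base using (ℕ; zero; suc; _+_; _≤_; _<_; z≤n; s≤s; s≤s⁻¹; _≤′_; ≤′-refl; ≤′-step)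
open import Data.Nat.Induction using (<-wellFounded)
import Data.Nat.Properties as ℕ
open import Data.Product.Base using (_×_; _,_; ∃; ∃-syntax; proj₁; proj₂)
open import Data.Product.Relation.Binary.Lex.Strict using (×-Lex; ×-wellFounded)
open import Data.Sum.Base using (_⊎_; inj₁; inj₂; [_,_]′; swap)
open import Data.Unit.Base using (⊤; tt)
open import Data.Vec.Base as Vec using (Vec; []; _∷_)
import Data.Vec.Relation.Unary.Any as Vec using (Any; here; there)
open import Function.Base using (_∘_; flip)
open import Function.Bundles using (_↔_; Inverse; mk↔ₛ′)
open import Function.Construct.Composition using (_↔-∘_)
open import Function.Construct.Identity using (↔-id)
open import Induction.WellFounded using (WellFounded; Acc; acc; module Subrelation)
open import Relation.Binary.Core using (Rel; _⇒_)
open import Relation.Binary.Definitions using (Empty)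
open import Relation.Binary.Construct.Closure.ReflexiveTransitive as Star using (Star; ε; _◅_; _◅◅_)
import Relation.Binary.Construct.Closure.ReflexiveTransitive.Properties as StarProperties
open import Relation.Binary.Construct.Closure.Symmetric using (fwd; bwd)
open import Relation.Binary.Construct.Closure.Equivalence as Eq using (EqClosure)
open import Relation.Binary.Construct.Union using (_∪_)
import Relation.Binary.Construct.On as On
open import Relation.Binary.PropositionalEquality
  using (_≡_; _≢_; refl; sym; trans; cong; cong₂; subst; subst₂)
open import Relation.Binary.Structures using (IsStrictPartialOrder)
open import Relation.Binary.Rewriting using (IsNormalForm)
open import Relation.Nullary using (¬_; yes; no; contradiction)

module Terms (𝓕 : Signature) (V : Set) where

  open Signature 𝓕
  open Rewriting 𝓕 V

  -- Substitutions.

  infixl 8 _⊙_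

  _⊙_ : Subst → Subst → Subst
  (σ ⊙ τ) x = σ x · τ

  ·-⊙  : ∀ t σ τ → t · (σ ⊙ τ) ≡ t · σ · τ
  ·*-⊙ : ∀ {n} (ts : Vec Term n) σ τ → ts ·* (σ ⊙ τ) ≡ ts ·* σ ·* τ

  ·-⊙ (var x)    σ τ = refl
  ·-⊙ (fun f ts) σ τ = cong (fun f) (·*-⊙ ts σ τ)

  ·*-⊙ []       σ τ = refl
  ·*-⊙ (t ∷ ts) σ τ = cong₂ _∷_ (·-⊙ t σ τ) (·*-⊙ ts σ τ)

  ·-cong  : ∀ t {σ τ} → (∀ x → x ∈ᵛ t → σ x ≡ τ x) → t · σ ≡ t · τ
  ·*-cong : ∀ {n} (ts : Vec Term n) {σ τ} →
            (∀ x → Vec.Any (x ∈ᵛ_) ts → σ x ≡ τ x) → ts ·* σ ≡ ts ·* τ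

  ·-cong (var x)    eq = eq x var
  ·-cong (fun f ts) eq = cong (fun f) (·*-cong ts λ x → eq x ∘ fun)

  ·*-cong []       eq = refl
  ·*-cong (t ∷ ts) eq =
    cong₂ _∷_ (·-cong t λ x → eq x ∘ Vec.here) (·*-cong ts λ x → eq x ∘ Vec.there)

  ·-id  : ∀ t → t · var ≡ t
  ·*-id : ∀ {n} (ts : Vec Term n) → ts ·* var ≡ ts

  ·-id (var x)    = refl
  ·-id (fun f ts) = cong (fun f) (·*-id ts)

  ·*-id []       = refl
  ·*-id (t ∷ ts) = cong₂ _∷_ (·-id t) (·*-id ts)

  -- The equality of symbols comes first, so that matching it with `refl` gives both argument
  -- vectors the same length before they are compared.
  fun-injective : ∀ {f g ss ts} → Term.fun f ss ≡ fun g ts →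
                  ∃[ eq ] subst (Vec Term ∘ arity) eq ss ≡ ts
  fun-injective refl = refl , refl

  -- Contexts.

  infixr 10 _∘ᶜ_ _∘ᶜ*_
  infixl 10 _·ᶜ_ _·ᶜ*_

  _∘ᶜ_  : Context → Context → Context
  _∘ᶜ*_ : ∀ {n} → Context* n → Context → Context* n

  □        ∘ᶜ D = D
  fun f Cs ∘ᶜ D = fun f (Cs ∘ᶜ* D)

  here C ts  ∘ᶜ* D = here (C ∘ᶜ D) ts
  there s Cs ∘ᶜ* D = there s (Cs ∘ᶜ* D)

  _·ᶜ_  : Context → Subst → Context
  _·ᶜ*_ : ∀ {n} → Context* n → Subst → Context* n

  □        ·ᶜ σ = □
  fun f Cs ·ᶜ σ = fun f (Cs ·ᶜ* σ)

  here C ts  ·ᶜ* σ = here (C ·ᶜ σ) (ts ·* σ)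
  there s Cs ·ᶜ* σ = there (s · σ) (Cs ·ᶜ* σ)

  ∘ᶜ-⟦⟧  : ∀ C {D t} → (C ∘ᶜ D) ⟦ t ⟧ ≡ C ⟦ D ⟦ t ⟧ ⟧
  ∘ᶜ*-⟦⟧ : ∀ {n} (Cs : Context* n) {D t} → (Cs ∘ᶜ* D) ⟦ t ⟧* ≡ Cs ⟦ D ⟦ t ⟧ ⟧*

  ∘ᶜ-⟦⟧ □          = refl
  ∘ᶜ-⟦⟧ (fun f Cs) = cong (fun f) (∘ᶜ*-⟦⟧ Cs)

  ∘ᶜ*-⟦⟧ (here C ts)  = cong (_∷ ts) (∘ᶜ-⟦⟧ C)
  ∘ᶜ*-⟦⟧ (there s Cs) = cong (s ∷_) (∘ᶜ*-⟦⟧ Cs)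

  ⟦⟧-·  : ∀ C {σ t} → C ⟦ t ⟧ · σ ≡ (C ·ᶜ σ) ⟦ t · σ ⟧
  ⟦⟧*-· : ∀ {n} (Cs : Context* n) {σ t} → Cs ⟦ t ⟧* ·* σ ≡ (Cs ·ᶜ* σ) ⟦ t · σ ⟧*

  ⟦⟧-· □          = refl
  ⟦⟧-· (fun f Cs) = cong (fun f) (⟦⟧*-· Cs)

  ⟦⟧*-· (here C ts)  = cong (_∷ _) (⟦⟧-· C)
  ⟦⟧*-· (there s Cs) = cong (_ ∷_) (⟦⟧*-· Cs)

  ·ᶜ-nonRoot : ∀ {C σ} → C ≢ □ → C ·ᶜ σ ≢ □
  ·ᶜ-nonRoot {□}        C≢□ _  = C≢□ refl
  ·ᶜ-nonRoot {fun f Cs} C≢□ ()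

  ∈ᵛ⇒⟦⟧  : ∀ {x t} → x ∈ᵛ t → ∃[ C ] t ≡ C ⟦ var x ⟧
  ∈ᵛ⇒⟦⟧* : ∀ {n x} {ts : Vec Term n} → Vec.Any (x ∈ᵛ_) ts → ∃[ Cs ] ts ≡ Cs ⟦ var x ⟧*

  ∈ᵛ⇒⟦⟧ var     = □ , refl
  ∈ᵛ⇒⟦⟧ (fun p) with Cs , eq ← ∈ᵛ⇒⟦⟧* p = fun _ Cs , cong (fun _) eq

  ∈ᵛ⇒⟦⟧* (Vec.here p)  with C , eq ← ∈ᵛ⇒⟦⟧ p = here C _ , cong (_∷ _) eq
  ∈ᵛ⇒⟦⟧* (Vec.there p) with Cs , eq ← ∈ᵛ⇒⟦⟧* p = there _ Cs , cong (_ ∷_) eq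

  -- Size of terms.

  -- The weights make variables the only terms of size 1.
  size  : Term → ℕ
  size* : ∀ {n} → Vec Term n → ℕ

  size (var x)    = 1
  size (fun f ts) = 2 + size* ts

  size* []       = 0
  size* (t ∷ ts) = size t + size* ts

  0<size : ∀ t → 0 < size t
  0<size (var x)    = s≤s z≤n
  0<size (fun f ts) = s≤s z≤n

  size-⟦⟧  : ∀ C t → C ≡ □ ⊎ size t < size (C ⟦ t ⟧)
  size-⟦⟧* : ∀ {n} (Cs : Context* n) t → size t ≤ size* (Cs ⟦ t ⟧*)

  size-⟦⟧ □          t = inj₁ refl
  size-⟦⟧ (fun f Cs) t = inj₂ (s≤s (ℕ.m≤n⇒m≤1+n (size-⟦⟧* Cs t)))

  size-⟦⟧* (here C ts) t with size-⟦⟧ C t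
  ... | inj₁ refl = ℕ.m≤m+n _ _
  ... | inj₂ lt   = ℕ.≤-trans (ℕ.<⇒≤ lt) (ℕ.m≤m+n _ _)
  size-⟦⟧* (there s Cs) t = ℕ.≤-trans (size-⟦⟧* Cs t) (ℕ.m≤n+m _ _)

  size-⟦⟧-≤ : ∀ C t → size t ≤ size (C ⟦ t ⟧)
  size-⟦⟧-≤ C t with size-⟦⟧ C t
  ... | inj₁ refl = ℕ.≤-refl
  ... | inj₂ lt   = ℕ.<⇒≤ lt

  size-·  : ∀ t σ → size t ≤ size (t · σ)
  size-·* : ∀ {n} (ts : Vec Term n) σ → size* ts ≤ size* (ts ·* σ)

  size-· (var x)    σ = 0<size (σ x)
  size-· (fun f ts) σ = s≤s (s≤s (size-·* ts σ))

  size-·* []       σ = z≤n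
  size-·* (t ∷ ts) σ = ℕ.+-mono-≤ (size-· t σ) (size-·* ts σ)

  size≤1⇒IsVar : ∀ t → size t ≤ 1 → IsVar t
  size≤1⇒IsVar (var x)    _        = var x
  size≤1⇒IsVar (fun f ts) (s≤s ())

  +-≤-split : ∀ {a b c d} → a ≤ c → b ≤ d → c + d ≤ a + b → c ≤ a × d ≤ b
  +-≤-split {a} {b} {c} {d} a≤c b≤d le =
    ℕ.+-cancelʳ-≤ d c a (ℕ.≤-trans le (ℕ.+-monoʳ-≤ a b≤d)) ,
    ℕ.+-cancelˡ-≤ c d b (ℕ.≤-trans le (ℕ.+-monoˡ-≤ b a≤c))

  -- Instantiation shrinks no argument, so if the total does not grow then no occurrence of a
  -- variable does, and `σ x` has size 1.
  size-·-reflects-var  : ∀ {t σ x} → x ∈ᵛ t → size (t · σ) ≤ size t → IsVar (σ x)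
  size-·*-reflects-var : ∀ {n} {ts : Vec Term n} {σ x} → Vec.Any (x ∈ᵛ_) ts →
                         size* (ts ·* σ) ≤ size* ts → IsVar (σ x)

  size-·-reflects-var var     le = size≤1⇒IsVar _ le
  size-·-reflects-var (fun p) le = size-·*-reflects-var p (s≤s⁻¹ (s≤s⁻¹ le))

  size-·*-reflects-var {ts = t ∷ ts} {σ} (Vec.here p)  le =
    size-·-reflects-var p (proj₁ (+-≤-split (size-· t σ) (size-·* ts σ) le))
  size-·*-reflects-var {ts = t ∷ ts} {σ} (Vec.there p) le =
    size-·*-reflects-var p (proj₂ (+-≤-split (size-· t σ) (size-·* ts σ) le))

  size-∈ᵛ : ∀ {x t} σ → x ∈ᵛ t → t ≢ var x → size (σ x) < size (t · σ)
  size-∈ᵛ σ x∈t t≢x with ∈ᵛ⇒⟦⟧ x∈t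
  ... | C , refl with size-⟦⟧ (C ·ᶜ σ) (σ _)
  ...   | inj₁ eq = contradiction eq (·ᶜ-nonRoot {C} λ { refl → t≢x refl })
  ...   | inj₂ lt = ℕ.<-≤-trans lt (ℕ.≤-reflexive (cong size (sym (⟦⟧-· C))))

  -- Lists of variables.

  vars  : Term → List V
  vars* : ∀ {n} → Vec Term n → List V

  vars (var x)    = x ∷ []
  vars (fun f ts) = vars* ts

  vars* []       = []
  vars* (t ∷ ts) = vars t ++ vars* ts

  ∈ᵛ⇒∈  : ∀ {x t} → x ∈ᵛ t → x ∈ vars t
  ∈ᵛ⇒∈* : ∀ {n x} {ts : Vec Term n} → Vec.Any (x ∈ᵛ_) ts → x ∈ vars* ts

  ∈ᵛ⇒∈ var     = here refl
  ∈ᵛ⇒∈ (fun p) = ∈ᵛ⇒∈* p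

  ∈ᵛ⇒∈* (Vec.here p)          = ∈-++⁺ˡ (∈ᵛ⇒∈ p)
  ∈ᵛ⇒∈* {ts = t ∷ _} (Vec.there p) = ∈-++⁺ʳ (vars t) (∈ᵛ⇒∈* p)

  vars-map  : ∀ t f → vars (t · (var ∘ f)) ≡ map f (vars t)
  vars-map* : ∀ {n} (ts : Vec Term n) f → vars* (ts ·* (var ∘ f)) ≡ map f (vars* ts)

  vars-map (var x)    f = refl
  vars-map (fun g ts) f = vars-map* ts f

  vars-map* []       f = refl
  vars-map* (t ∷ ts) f = trans (cong₂ _++_ (vars-map t f) (vars-map* ts f))
                               (sym (map-++ f (vars t) (vars* ts)))

  -- Encompassment and rewrite steps.

  ⟦⟧-∘ : ∀ l {σ τ} C D → C ⟦ (D ⟦ l · τ ⟧) · σ ⟧ ≡ (C ∘ᶜ (D ·ᶜ σ)) ⟦ l · (τ ⊙ σ) ⟧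
  ⟦⟧-∘ l {σ} {τ} C D =
    trans (cong (C ⟦_⟧) (trans (⟦⟧-· D) (cong ((D ·ᶜ σ) ⟦_⟧) (sym (·-⊙ l τ σ)))))
          (sym (∘ᶜ-⟦⟧ C))

  Encompasses-trans : ∀ s t u → Encompasses s t → Encompasses t u → Encompasses s u
  Encompasses-trans _ _ u (C , σ , refl) (D , τ , refl) =
    C ∘ᶜ (D ·ᶜ σ) , τ ⊙ σ , ⟦⟧-∘ u C D

  ⊵-▷-trans : ∀ s t u → Encompasses s t → ProperlyEncompasses t u → ProperlyEncompasses s u
  ⊵-▷-trans s t u s⊵t (t⊵u , u⋭t) =
    Encompasses-trans s t u s⊵t t⊵u , λ u⊵s → u⋭t (Encompasses-trans u s t u⊵s s⊵t)

  -- A rewrite step by one given pair, which stays visible because later inductions run over its two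
  -- sides. The endpoints are described by equations so that `s` and `t` may be arbitrary terms.
  data Inst (l r s t : Term) : Set where
    inst : ∀ C σ → s ≡ C ⟦ l · σ ⟧ → t ≡ C ⟦ r · σ ⟧ → Inst l r s t

  Inst-closed : ∀ {l r s t} C σ → Inst l r s t → Inst l r (C ⟦ s · σ ⟧) (C ⟦ t · σ ⟧)
  Inst-closed {l} {r} C σ (inst D τ refl refl) =
    inst (C ∘ᶜ (D ·ᶜ σ)) (τ ⊙ σ) (⟦⟧-∘ l C D) (⟦⟧-∘ r C D)

  Inst⇒Encompasses : ∀ {l r s t} → Inst l r s t → Encompasses s l
  Inst⇒Encompasses (inst C σ eq _) = C , σ , eq

  Inst⇒Step : ∀ {X : ES} {l r s t} → X l r → Inst l r s t → Step X s t
  Inst⇒Step Xlr (inst C σ refl refl) = step Xlr C σ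

  Step⇒Inst : ∀ {X : ES} {s t} → Step X s t → ∃[ l ] ∃[ r ] X l r × Inst l r s t
  Step⇒Inst (step Xlr C σ) = _ , _ , Xlr , inst C σ refl refl

  Step-closed : ∀ {X : ES} {s t} C σ → Step X s t → Step X (C ⟦ s · σ ⟧) (C ⟦ t · σ ⟧)
  Step-closed C σ st with _ , _ , Xlr , i ← Step⇒Inst st = Inst⇒Step Xlr (Inst-closed C σ i)

  Step-⟦⟧ : ∀ {X : ES} {s t} C → Step X s t → Step X (C ⟦ s ⟧) (C ⟦ t ⟧)
  Step-⟦⟧ {s = s} {t} C st =
    subst₂ (λ a b → Step _ (C ⟦ a ⟧) (C ⟦ b ⟧)) (·-id s) (·-id t) (Step-closed C var st)

  Step-map : ∀ {X Y : ES} → X ⇒ Y → Step X ⇒ Step Y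
  Step-map f (step Xlr C σ) = step (f Xlr) C σ

  data Step* (X : ES) {n} : Rel (Vec Term n) 0ℓ where
    step : ∀ {s t} Cs → Step X s t → Step* X (Cs ⟦ s ⟧*) (Cs ⟦ t ⟧*)

  Step*-fun : ∀ {X : ES} {f ss ts} → Step* X ss ts → Step X (fun f ss) (fun f ts)
  Step*-fun {f = f} (step Cs st) = Step-⟦⟧ (fun f Cs) st

  Step*-here : ∀ {X : ES} {n s t} {ts : Vec Term n} → Step X s t → Step* X (s ∷ ts) (t ∷ ts)
  Step*-here {ts = ts} = step (here □ ts)

  Step*-there : ∀ {X : ES} {n s} {ss ts : Vec Term n} → Step* X ss ts → Step* X (s ∷ ss) (s ∷ ts)
  Step*-there {s = s} (step Cs st) = step (there s Cs) st

  Star*-∷ : ∀ {X : ES} {n s t} {ss ts : Vec Term n} →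
            Star (Step X) s t → Star (Step* X) ss ts → Star (Step* X) (s ∷ ss) (t ∷ ts)
  Star*-∷ {ss = ss} {ts} st sts =
    Star.gmap (_∷ ss) Step*-here st ◅◅ Star.gmap (_ ∷_) Step*-there sts

  Star-·  : ∀ {X : ES} {σ τ} t → (∀ x → Star (Step X) (σ x) (τ x)) → Star (Step X) (t · σ) (t · τ)
  Star-·* : ∀ {X : ES} {σ τ n} (ts : Vec Term n) → (∀ x → Star (Step X) (σ x) (τ x)) →
            Star (Step* X) (ts ·* σ) (ts ·* τ)

  Star-· (var x)    σ→τ = σ→τ x
  Star-· (fun f ts) σ→τ = Star.gmap (fun f) Step*-fun (Star-·* ts σ→τ)

  Star-·* []       σ→τ = ε
  Star-·* (t ∷ ts) σ→τ = Star*-∷ (Star-· t σ→τ) (Star-·* ts σ→τ)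

  -- Relative positions of redexes.

  subterm-context  : ∀ t (q : Pos t) → ∃[ C ] t ≡ C ⟦ t ∣ q ⟧ × (q ≢ ε → C ≢ □)
  lookup-context*  : ∀ {n} (ts : Vec Term n) i → ∃[ Cs ] (∀ {C t} → Vec.lookup ts i ≡ C ⟦ t ⟧ →
                     ts ≡ Cs C ⟦ t ⟧*)

  subterm-context t          ε       = □ , refl , λ ε≢ε _ → ε≢ε refl
  subterm-context (fun f ts) (i ∷ q)
    with C , eq , _ ← subterm-context (Vec.lookup ts i) q | Cs , eq* ← lookup-context* ts i =
    fun f (Cs C) , cong (fun f) (eq* eq) , λ _ ()

  lookup-context* (t ∷ ts) zero    = (λ C → here C ts) , cong (_∷ ts)
  lookup-context* (t ∷ ts) (suc i) with Cs , eq* ← lookup-context* ts i =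
    there t ∘ Cs , cong (t ∷_) ∘ eq*

  module Locate (X : ES) {σ : Subst} where

    -- The hole of an instance l · σ = C ⟦ t ⟧ lies at a non-variable position
    -- of l or inside the substituted part.  In the latter case the other
    -- occurrences of the variable are rewritten as well.
    data Location (C : Context) (l t : Term) : Set where
      at    : (p : Pos l) → ¬ IsVar (l ∣ p) → (l ∣ p) · σ ≡ t →
              (∀ u → (l [ p ]≔ u) · σ ≡ C ⟦ u · σ ⟧) → Location C l t
      below : ∀ x D → σ x ≡ D ⟦ t ⟧ →
              (∀ {u τ} → τ x ≡ D ⟦ u ⟧ → (∀ y → Star (Step X) (σ y) (τ y)) →
               Star (Step X) (C ⟦ u ⟧) (l · τ)) → Location C l t

    data Location* {n} (Cs : Context* n) (ls : Vec Term n) (t : Term) : Set where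
      at    : ∀ i (p : Pos (Vec.lookup ls i)) → ¬ IsVar (Vec.lookup ls i ∣ p) →
              (Vec.lookup ls i ∣ p) · σ ≡ t →
              (∀ u → (ls Vec.[ i ]≔ (Vec.lookup ls i [ p ]≔ u)) ·* σ ≡ Cs ⟦ u · σ ⟧*) →
              Location* Cs ls t
      below : ∀ x D → σ x ≡ D ⟦ t ⟧ →
              (∀ {u τ} → τ x ≡ D ⟦ u ⟧ → (∀ y → Star (Step X) (σ y) (τ y)) →
               Star (Step* X) (Cs ⟦ u ⟧*) (ls ·* τ)) → Location* Cs ls t

    -- Descend through `C` and `l` together. If a variable of `l` is met, what remains of `C` lies
    -- inside its value; if the hole is met first, the function symbol of `l` reached there gives a
    -- non-variable position.
    locate  : ∀ C l {t} → C ⟦ t ⟧ ≡ l · σ → Location C l t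
    locate* : ∀ {n} (Cs : Context* n) ls {t} → Cs ⟦ t ⟧* ≡ ls ·* σ → Location* Cs ls t

    locate C          (var x)    eq   = below x C (sym eq) λ τx≡ _ → StarProperties.reflexive _ (sym τx≡)
    locate □          (fun f ls) refl = at ε (λ ()) refl λ _ → refl
    locate (fun f Cs) (fun g ls) eq with refl , eq* ← fun-injective eq with locate* Cs ls eq*
    ... | at i p nonVar eq′ replace = at (i ∷ p) nonVar eq′ (cong (fun f) ∘ replace)
    ... | below x D eq′ rejoin      = below x D eq′ λ τx≡ σ→τ →
      Star.gmap (fun f) Step*-fun (rejoin τx≡ σ→τ)

    locate* (here C ts) (l ∷ ls) eq with refl ← cong Vec.tail eq with locate C l (cong Vec.head eq)
    ... | at p nonVar eq′ replace = at zero p nonVar eq′ λ u → cong (_∷ _) (replace u)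
    ... | below x D eq′ rejoin    = below x D eq′ λ τx≡ σ→τ →
      Star*-∷ (rejoin τx≡ σ→τ) (Star-·* ls σ→τ)
    locate* (there s Cs) (l ∷ ls) eq with refl ← cong Vec.head eq with locate* Cs ls (cong Vec.tail eq)
    ... | at i p nonVar eq′ replace = at (suc i) p nonVar eq′ λ u → cong (_ ∷_) (replace u)
    ... | below x D eq′ rejoin      = below x D eq′ λ τx≡ σ→τ →
      Star*-∷ (Star-· l σ→τ) (rejoin τx≡ σ→τ)

  -- Equal holes count as `inside`, whereas `outside` is strict. For parallel holes, `w` is the term
  -- with both holes refilled, a common reduct once both contractions are steps.
  data Comparison (X : ES) (C D : Context) (a b : Term) : Set where
    inside   : ∀ E → C ≡ D ∘ᶜ E → b ≡ E ⟦ a ⟧ → Comparison X C D a b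
    outside  : ∀ E → E ≢ □ → a ≡ E ⟦ b ⟧ → Comparison X C D a b
    parallel : (∀ a′ b′ → ∃[ w ] (Step X b b′ → Step X (C ⟦ a′ ⟧) w) ×
                                 (Step X a a′ → Step X (D ⟦ b′ ⟧) w)) → Comparison X C D a b

  data Comparison* (X : ES) {n} (Cs Ds : Context* n) (a b : Term) : Set where
    inside   : ∀ E → Cs ≡ Ds ∘ᶜ* E → b ≡ E ⟦ a ⟧ → Comparison* X Cs Ds a b
    outside  : ∀ E → E ≢ □ → a ≡ E ⟦ b ⟧ → Comparison* X Cs Ds a b
    parallel : (∀ a′ b′ → ∃[ ws ] (Step X b b′ → Step* X (Cs ⟦ a′ ⟧*) ws) ×
                                  (Step X a a′ → Step* X (Ds ⟦ b′ ⟧*) ws)) → Comparison* X Cs Ds a b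

  compare  : ∀ X C D {a b} → C ⟦ a ⟧ ≡ D ⟦ b ⟧ → Comparison X C D a b
  compare* : ∀ X {n} (Cs Ds : Context* n) {a b} → Cs ⟦ a ⟧* ≡ Ds ⟦ b ⟧* → Comparison* X Cs Ds a b

  compare X C          □          eq = inside C refl (sym eq)
  compare X □          (fun g Ds) eq = outside (fun g Ds) (λ ()) eq
  compare X (fun f Cs) (fun g Ds) eq with refl , eq* ← fun-injective eq with compare* X Cs Ds eq*
  ... | inside E refl eq′   = inside E refl eq′
  ... | outside E E≢□ eq′   = outside E E≢□ eq′
  ... | parallel commute    = parallel λ a′ b′ →
    let ws , b→ , a→ = commute a′ b′ in fun f ws , Step*-fun ∘ b→ , Step*-fun ∘ a→

  compare* X (here C ts) (here D us) eq with refl ← cong Vec.tail eq with compare X C D (cong Vec.head eq)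
  ... | inside E refl eq′   = inside E refl eq′
  ... | outside E E≢□ eq′   = outside E E≢□ eq′
  ... | parallel commute    = parallel λ a′ b′ →
    let w , b→ , a→ = commute a′ b′ in w ∷ ts , Step*-here ∘ b→ , Step*-here ∘ a→
  compare* X (there s Cs) (there u Ds) eq with refl ← cong Vec.head eq
                                          with compare* X Cs Ds (cong Vec.tail eq)
  ... | inside E refl eq′   = inside E refl eq′
  ... | outside E E≢□ eq′   = outside E E≢□ eq′
  ... | parallel commute    = parallel λ a′ b′ →
    let ws , b→ , a→ = commute a′ b′ in s ∷ ws , Step*-there ∘ b→ , Step*-there ∘ a→
  compare* X (here C ts) (there s Ds) refl = parallel λ a′ b′ →
    C ⟦ a′ ⟧ ∷ Ds ⟦ b′ ⟧* , step (there _ Ds) , Step*-here ∘ Step-⟦⟧ C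
  compare* X (there s Cs) (here D us) refl = parallel λ a′ b′ →
    D ⟦ b′ ⟧ ∷ Cs ⟦ a′ ⟧* , Step*-here ∘ Step-⟦⟧ D , step (there _ Cs)

module Classical (em : ExcludedMiddle 0ℓ) (𝓕 : Signature) (V : Set) where

  open Signature 𝓕
  open Rewriting 𝓕 V
  open Terms 𝓕 V

  -- Well-foundedness of proper encompassment.

  occurrences : V → List V → ℕ
  occurrences x []       = 0
  occurrences x (y ∷ ys) with em {y ≡ x}
  ... | yes _ = suc (occurrences x ys)
  ... | no  _ = occurrences x ys

  -- Counts the pairs of equal entries, and so measures how far a list of
  -- variables is from being linear.
  repetitions : List V → ℕ
  repetitions []       = 0
  repetitions (x ∷ xs) = occurrences x xs + repetitions xs

  occurrences-map : ∀ f x xs → occurrences x xs ≤ occurrences (f x) (map f xs)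
  occurrences-map f x []       = z≤n
  occurrences-map f x (y ∷ ys) with em {y ≡ x} | em {f y ≡ f x}
  ... | yes eq | yes _  = s≤s (occurrences-map f x ys)
  ... | yes eq | no neq = contradiction (cong f eq) neq
  ... | no _   | yes _  = ℕ.m≤n⇒m≤1+n (occurrences-map f x ys)
  ... | no _   | no _   = occurrences-map f x ys

  -- An entry `y ≢ x` with `f y ≡ f x` would be counted after mapping but not before, so the count
  -- would grow.
  occurrences-map-reflects : ∀ f x xs → occurrences (f x) (map f xs) ≤ occurrences x xs →
                             ∀ {y} → y ∈ xs → f y ≡ f x → y ≡ x
  occurrences-map-reflects f x (y ∷ ys) le y∈ with em {y ≡ x} | em {f y ≡ f x}
  occurrences-map-reflects f x (y ∷ ys) le (here refl) | yes eq | _     = λ _ → eq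
  occurrences-map-reflects f x (y ∷ ys) le (there y∈)  | yes eq | yes _ =
    occurrences-map-reflects f x ys (s≤s⁻¹ le) y∈
  occurrences-map-reflects f x (y ∷ ys) le _           | yes eq | no neq = contradiction (cong f eq) neq
  occurrences-map-reflects f x (y ∷ ys) le _           | no _   | yes _ =
    contradiction (ℕ.≤-trans le (occurrences-map f x ys)) ℕ.1+n≰n
  occurrences-map-reflects f x (y ∷ ys) le (here refl) | no _   | no neq = λ eq → contradiction eq neq
  occurrences-map-reflects f x (y ∷ ys) le (there y∈)  | no _   | no neq =
    occurrences-map-reflects f x ys le y∈

  repetitions-map : ∀ f xs → repetitions xs ≤ repetitions (map f xs)
  repetitions-map f []       = z≤n
  repetitions-map f (x ∷ xs) = ℕ.+-mono-≤ (occurrences-map f x xs) (repetitions-map f xs)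

  repetitions-map-reflects : ∀ f xs → repetitions (map f xs) ≤ repetitions xs →
                             ∀ {x y} → x ∈ xs → y ∈ xs → f x ≡ f y → x ≡ y
  repetitions-map-reflects f (z ∷ zs) le = go
    where
    split = +-≤-split (occurrences-map f z zs) (repetitions-map f zs) le

    go : ∀ {x y} → x ∈ z ∷ zs → y ∈ z ∷ zs → f x ≡ f y → x ≡ y
    go (here refl) (here refl) _  = refl
    go (here refl) (there y∈)  eq = sym (occurrences-map-reflects f z zs (proj₁ split) y∈ (sym eq))
    go (there x∈)  (here refl) eq = occurrences-map-reflects f z zs (proj₁ split) x∈ eq
    go (there x∈)  (there y∈)  eq = repetitions-map-reflects f zs (proj₂ split) x∈ y∈ eq

  renaming-invertible : ∀ t (f : V → V) →
                        (∀ {x y} → x ∈ᵛ t → y ∈ᵛ t → f x ≡ f y → x ≡ y) →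
                        ∃[ ρ ] t · (var ∘ f) · ρ ≡ t
  renaming-invertible t f inj =
    ρ , trans (sym (·-⊙ t (var ∘ f) ρ)) (trans (·-cong t ρ∘f) (·-id t))
    where
    ρ : Subst
    ρ y with em {∃[ x ] x ∈ᵛ t × f x ≡ y}
    ... | yes (x , _) = var x
    -- A default value: every variable of `t · (var ∘ f)` has a preimage in `t`.
    ... | no _        = var y

    ρ∘f : ∀ x → x ∈ᵛ t → ρ (f x) ≡ var x
    ρ∘f x x∈t with em {∃[ y ] y ∈ᵛ t × f y ≡ f x}
    ... | yes (y , y∈t , eq) = cong var (inj y∈t x∈t eq)
    ... | no ∄               = contradiction (x , x∈t , refl) ∄

  measure : Term → ℕ × ℕ
  measure t = size t , repetitions (vars t)

  -- If t = C[uσ] is not larger than u, then C = □ and σ only renames the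
  -- variables of u; if moreover t repeats no more variables than u, then σ is
  -- injective on them and can be undone.
  ProperlyEncompasses⇒measure : ∀ {t u} → ProperlyEncompasses t u →
                                ×-Lex _≡_ _<_ _<_ (measure u) (measure t)
  ProperlyEncompasses⇒measure {u = u} ((C , σ , refl) , u⋭t) = sizes (size-⟦⟧ C (u · σ))
    where
    Goal = ×-Lex _≡_ _<_ _<_ (measure u) (measure (C ⟦ u · σ ⟧))

    module _ (C≡□ : C ≡ □) (eq : size u ≡ size (u · σ)) where

      f : V → V
      f x with σ x
      ... | var y   = y
      -- Never reached on variables of `u`: there `size-·-reflects-var` forces `σ x` to be a
      -- variable.
      ... | fun _ _ = x

      var∘f : ∀ x → x ∈ᵛ u → σ x ≡ var (f x)
      var∘f x x∈u with σ x | size-·-reflects-var {σ = σ} x∈u (ℕ.≤-reflexive (sym eq))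
      ... | var y | var .y = refl

      renames : u · σ ≡ u · (var ∘ f)
      renames = ·-cong u var∘f

      repeats : repetitions (vars u) < repetitions (vars (u · σ))
      repeats with repetitions (vars (u · σ)) ℕ.≤? repetitions (vars u)
      ... | no  ≰r = ℕ.≰⇒> ≰r
      ... | yes ≤r = contradiction u⊵t u⋭t
        where
        inj : ∀ {x y} → x ∈ᵛ u → y ∈ᵛ u → f x ≡ f y → x ≡ y
        inj x∈u y∈u = repetitions-map-reflects f (vars u)
          (subst (λ xs → repetitions xs ≤ repetitions (vars u))
                 (trans (cong vars renames) (vars-map u f)) ≤r)
          (∈ᵛ⇒∈ x∈u) (∈ᵛ⇒∈ y∈u)

        u⊵t : Encompasses u (C ⟦ u · σ ⟧)
        u⊵t with ρ , undo ← renaming-invertible u f inj =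
          □ , ρ , sym (trans (cong (λ D → D ⟦ u · σ ⟧ · ρ) C≡□)
                             (trans (cong (_· ρ) renames) undo))

      sameSize : Goal
      sameSize = subst (λ D → ×-Lex _≡_ _<_ _<_ (measure u) (measure (D ⟦ u · σ ⟧)))
                       (sym C≡□) (inj₂ (eq , repeats))

    sizes : C ≡ □ ⊎ size (u · σ) < size (C ⟦ u · σ ⟧) → Goal
    sizes (inj₂ lt)  = inj₁ (ℕ.≤-<-trans (size-· u σ) lt)
    sizes (inj₁ C≡□) with ℕ.m≤n⇒m<n∨m≡n (size-· u σ)
    ... | inj₁ lt = inj₁ (ℕ.<-≤-trans lt (size-⟦⟧-≤ C (u · σ)))
    ... | inj₂ eq = sameSize C≡□ eq

  properlyEncompasses-wellFounded : WellFounded (flip ProperlyEncompasses)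
  properlyEncompasses-wellFounded =
    Subrelation.wellFounded ProperlyEncompasses⇒measure
      (On.wellFounded measure (×-wellFounded <-wellFounded <-wellFounded))

  -- Most general unifiers.

  Unifies* : Subst → List (Term × Term) → Set
  Unifies* σ = All λ (s , t) → Unifies σ s t

  -- Every unifier factors through `μ` with itself as the second factor; for `μ` itself this is
  -- idempotence. No witness for the factor has to be carried through the algorithm.
  IsIdempotentMGU : Subst → List (Term × Term) → Set
  IsIdempotentMGU μ es = Unifies* μ es × (∀ τ → Unifies* τ es → ∀ x → τ x ≡ μ x · τ)

  mgu-resp : ∀ {μ es fs} → (∀ {σ} → Unifies* σ es → Unifies* σ fs) →
             (∀ {σ} → Unifies* σ fs → Unifies* σ es) → IsIdempotentMGU μ es → IsIdempotentMGU μ fs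
  mgu-resp f g (unif , general) = f unif , λ τ → general τ ∘ g

  -- Only left-hand sides are weighed: under a unifier `τ` both sides of a pair have the same
  -- instance.
  weight : Subst → List (Term × Term) → ℕ
  weight τ []             = 0
  weight τ ((s , _) ∷ es) = size (s · τ) + weight τ es

  pairs : ∀ {n} → Vec Term n → Vec Term n → List (Term × Term)
  pairs []       []       = []
  pairs (s ∷ ss) (t ∷ ts) = (s , t) ∷ pairs ss ts

  weight-pairs : ∀ {n} τ (ss ts : Vec Term n) es →
                 weight τ (pairs ss ts ++ es) ≡ size* (ss ·* τ) + weight τ es
  weight-pairs τ []       []       es = refl
  weight-pairs τ (s ∷ ss) (t ∷ ts) es =
    trans (cong (size (s · τ) +_) (weight-pairs τ ss ts es)) (sym (ℕ.+-assoc (size (s · τ)) _ _))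

  pairs⁺ : ∀ {n σ} (ss ts : Vec Term n) → ss ·* σ ≡ ts ·* σ → Unifies* σ (pairs ss ts)
  pairs⁺ []       []       _  = []
  pairs⁺ (s ∷ ss) (t ∷ ts) eq = cong Vec.head eq ∷ pairs⁺ ss ts (cong Vec.tail eq)

  pairs⁻ : ∀ {n σ} (ss ts : Vec Term n) → Unifies* σ (pairs ss ts) → ss ·* σ ≡ ts ·* σ
  pairs⁻ []       []       _          = refl
  pairs⁻ (s ∷ ss) (t ∷ ts) (eq ∷ eqs) = cong₂ _∷_ eq (pairs⁻ ss ts eqs)

  decompose : ∀ {σ f es} (ss ts : Vec Term (arity f)) →
              Unifies* σ (pairs ss ts ++ es) → Unifies* σ ((fun f ss , fun f ts) ∷ es)
  decompose {f = f} ss ts u with p , q ← All.++⁻ (pairs ss ts) u = cong (fun f) (pairs⁻ ss ts p) ∷ q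

  recompose : ∀ {σ f es} (ss ts : Vec Term (arity f)) →
              Unifies* σ ((fun f ss , fun f ts) ∷ es) → Unifies* σ (pairs ss ts ++ es)
  recompose ss ts (eq ∷ u) with refl , eq* ← fun-injective eq = All.++⁺ (pairs⁺ ss ts eq*) u

  _⟨_↦_⟩ : Subst → V → Term → Subst
  (σ ⟨ x ↦ t ⟩) y with em {y ≡ x}
  ... | yes _ = t
  ... | no  _ = σ y

  [_↦_] : V → Term → Subst
  [_↦_] = var ⟨_↦_⟩

  [↦]-self : ∀ σ x t → (σ ⟨ x ↦ t ⟩) x ≡ t
  [↦]-self σ x t with em {x ≡ x}
  ... | yes _  = refl
  ... | no x≢x = contradiction refl x≢x

  [↦]-fresh : ∀ {x} t u → ¬ x ∈ᵛ t → t · [ x ↦ u ] ≡ t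
  [↦]-fresh {x} t u x∉t = trans (·-cong t fresh) (·-id t)
    where
    fresh : ∀ y → y ∈ᵛ t → [ x ↦ u ] y ≡ var y
    fresh y y∈t with em {y ≡ x}
    ... | yes refl = contradiction y∈t x∉t
    ... | no _     = refl

  [↦]-absorbed : ∀ {x t τ} → τ x ≡ t · τ → ∀ y → ([ x ↦ t ] ⊙ τ) y ≡ τ y
  [↦]-absorbed {x} eq y with em {y ≡ x}
  ... | yes refl = sym eq
  ... | no _     = refl

  [↦]-absorbed-· : ∀ {x t τ} → τ x ≡ t · τ → ∀ s → s · [ x ↦ t ] · τ ≡ s · τ
  [↦]-absorbed-· {x} {t} {τ} eq s =
    trans (sym (·-⊙ s [ x ↦ t ] τ)) (·-cong s λ y _ → [↦]-absorbed eq y)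

  instantiate : Subst → List (Term × Term) → List (Term × Term)
  instantiate σ = map λ (s , t) → s · σ , t · σ

  Unifies*-⊙ : ∀ {σ τ} es → Unifies* τ (instantiate σ es) → Unifies* (σ ⊙ τ) es
  Unifies*-⊙ []             []       = []
  Unifies*-⊙ {σ} {τ} ((s , t) ∷ es) (eq ∷ u) =
    trans (·-⊙ s σ τ) (trans eq (sym (·-⊙ t σ τ))) ∷ Unifies*-⊙ es u

  module _ {x t τ} (eq : τ x ≡ t · τ) where

    weight-eliminate : ∀ es → weight τ (instantiate [ x ↦ t ] es) ≡ weight τ es
    weight-eliminate []             = refl
    weight-eliminate ((s , _) ∷ es) =
      cong₂ _+_ (cong size ([↦]-absorbed-· eq s)) (weight-eliminate es)

    Unifies*-eliminate : ∀ es → Unifies* τ es → Unifies* τ (instantiate [ x ↦ t ] es)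
    Unifies*-eliminate []             []        = []
    Unifies*-eliminate ((s , u) ∷ es) (eq′ ∷ us) =
      trans ([↦]-absorbed-· eq s) (trans eq′ (sym ([↦]-absorbed-· eq u))) ∷ Unifies*-eliminate es us

  -- Since `x` does not occur in `t`, the substitution `[ x ↦ t ]` leaves `t` alone and solves the
  -- first equation. A unifier of all equations absorbs `[ x ↦ t ]`, hence unifies the instantiated
  -- rest and absorbs `μ` as well.
  mgu-eliminate : ∀ {μ x t es} → ¬ x ∈ᵛ t → IsIdempotentMGU μ (instantiate [ x ↦ t ] es) →
                  IsIdempotentMGU ([ x ↦ t ] ⊙ μ) ((var x , t) ∷ es)
  mgu-eliminate {μ} {x} {t} {es} x∉t (unif , general) =
    trans (cong (_· μ) ([↦]-self var x t))
          (sym (trans (·-⊙ t [ x ↦ t ] μ) (cong (_· μ) ([↦]-fresh t t x∉t)))) ∷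
    Unifies*-⊙ es unif ,
    general′
    where
    general′ : ∀ τ → Unifies* τ ((var x , t) ∷ es) → ∀ y → τ y ≡ [ x ↦ t ] y · μ · τ
    general′ τ (eq ∷ u) y = sym (trans (sym (·-⊙ ([ x ↦ t ] y) μ τ))
      (trans (sym (·-cong ([ x ↦ t ] y) λ z _ → general τ (Unifies*-eliminate eq es u) z))
             ([↦]-absorbed eq y)))

  -- Recursion on the size of the instances under the given unifier τ, which
  -- decreases in every step of the usual algorithm: eliminating a variable
  -- does not change these instances, as τ absorbs the eliminating substitution.
  mgu-exists : ∀ es {τ} → Unifies* τ es → ∃[ μ ] IsIdempotentMGU μ es
  mgu-exists es {τ} u = solve (suc (weight τ es)) es u (ℕ.n<1+n _)
    where
    solve : ∀ n es → Unifies* τ es → weight τ es < n → ∃[ μ ] IsIdempotentMGU μ es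

    solve-var : ∀ n x t es → τ x ≡ t · τ → Unifies* τ es → weight τ es < n →
                ∃[ μ ] IsIdempotentMGU μ ((var x , t) ∷ es)
    solve-var n x t es eq u lt with em {x ∈ᵛ t}
    ... | no x∉t =
      let μ , mgu = solve n (instantiate [ x ↦ t ] es) (Unifies*-eliminate eq es u)
                      (ℕ.≤-<-trans (ℕ.≤-reflexive (weight-eliminate eq es)) lt)
      in [ x ↦ t ] ⊙ μ , mgu-eliminate x∉t mgu
    ... | yes x∈t with em {t ≡ var x}
    ...   | yes refl = let μ , mgu = solve n es u lt in μ , mgu-resp (refl ∷_) All.tail mgu
    -- Occurs check: `x` lies properly inside `t`, so `τ x` is smaller than `t · τ`, to which it
    -- should be equal.
    ...   | no t≢x   = contradiction (cong size eq) (ℕ.<⇒≢ (size-∈ᵛ τ x∈t t≢x))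

    solve (suc n) []             []       _  = var , [] , λ _ _ _ → refl
    solve (suc n) ((var x , t) ∷ es) (eq ∷ u) lt =
      solve-var n x t es eq u (ℕ.<-≤-trans (ℕ.+-monoˡ-< (weight τ es) (0<size (τ x))) (s≤s⁻¹ lt))
    solve (suc n) ((fun f ss , var x) ∷ es) (eq ∷ u) lt =
      let μ , mgu = solve-var n x (fun f ss) es (sym eq) u
                      (ℕ.<-≤-trans (ℕ.+-monoˡ-< (weight τ es) (0<size (fun f ss · τ))) (s≤s⁻¹ lt))
      in μ , mgu-resp flipped flipped mgu
      where
      flipped : ∀ {σ s t} → Unifies* σ ((s , t) ∷ es) → Unifies* σ ((t , s) ∷ es)
      flipped (eq ∷ u) = sym eq ∷ u
    solve (suc n) ((fun f ss , fun g ts) ∷ es) (eq ∷ u) lt with refl , _ ← fun-injective eq =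
      let μ , mgu = solve n (pairs ss ts ++ es) (recompose ss ts (eq ∷ u))
                      (ℕ.≤-<-trans (ℕ.≤-reflexive (weight-pairs τ ss ts es))
                        (s≤s⁻¹ (ℕ.<-trans (ℕ.n<1+n _) lt)))
      in μ , mgu-resp (decompose ss ts) (recompose ss ts) mgu

  unifiable⇒mgu : ∀ {s t τ} → Unifies τ s t → ∃[ μ ] IsMGU μ s t
  unifiable⇒mgu {s} {t} eq with μ , eq′ ∷ [] , general ← mgu-exists ((s , t) ∷ []) (eq ∷ []) =
    μ , eq′ , λ τ eq → τ , general τ (eq ∷ [])

  -- Renaming apart.

  transpose : V → V → V → V
  transpose a b x with em {x ≡ a} | em {x ≡ b}
  ... | yes _ | _     = b
  ... | no _  | yes _ = a
  ... | no _  | no _  = x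

  transpose-left : ∀ a b → transpose a b a ≡ b
  transpose-left a b with em {a ≡ a}
  ... | yes _  = refl
  ... | no a≢a = contradiction refl a≢a

  transpose-fixed : ∀ {a b x} → x ≢ a → x ≢ b → transpose a b x ≡ x
  transpose-fixed {a} {b} {x} x≢a x≢b with em {x ≡ a} | em {x ≡ b}
  ... | yes eq | _      = contradiction eq x≢a
  ... | no _   | yes eq = contradiction eq x≢b
  ... | no _   | no _   = refl

  transpose-right : ∀ a b → transpose a b b ≡ a
  transpose-right a b with em {b ≡ a} | em {b ≡ b}
  ... | yes eq | _      = eq
  ... | no _   | yes _  = refl
  ... | no _   | no b≢b = contradiction refl b≢b

  transpose-involutive : ∀ a b x → transpose a b (transpose a b x) ≡ x
  transpose-involutive a b x with em {x ≡ a} | em {x ≡ b}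
  ... | yes refl | _        = transpose-right a b
  ... | no _     | yes refl = transpose-left a b
  ... | no x≢a   | no x≢b   = transpose-fixed x≢a x≢b

  transposition : V → V → V ↔ V
  transposition a b = mk↔ₛ′ (transpose a b) (transpose a b)
                            (transpose-involutive a b) (transpose-involutive a b)

  -- Variables are moved one at a time. If `π` sends `x` into `ys`, its image is swapped with a
  -- variable `b` outside `ys` and outside the images of `xs`; those images avoid both swapped
  -- variables and stay where they are.
  rename-apart : Infinite V → ∀ xs ys →
                 ∃ λ (π : V ↔ V) → ∀ {x} → x ∈ xs → ¬ Inverse.to π x ∈ ys
  rename-apart inf []       ys = ↔-id V , λ ()
  rename-apart inf (x ∷ xs) ys with π , apart ← rename-apart inf xs ys
                                  | em {Inverse.to π x ∈ ys}
  ... | no πx∉ys  = π , λ { (here refl) → πx∉ys ; (there z∈) → apart z∈ }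
  ... | yes πx∈ys with b , b∉ ← inf (ys ++ map (Inverse.to π) xs) =
    transposition a b ↔-∘ π , moved
    where
    a = Inverse.to π x

    moved : ∀ {z} → z ∈ x ∷ xs → ¬ transpose a b (Inverse.to π z) ∈ ys
    moved (here refl) ∈ys = b∉ (∈-++⁺ˡ (subst (_∈ ys) (transpose-left a b) ∈ys))
    moved (there z∈)  ∈ys = apart z∈ (subst (_∈ ys) (transpose-fixed
      (λ eq → apart z∈ (subst (_∈ ys) (sym eq) πx∈ys))
      (λ eq → b∉ (∈-++⁺ʳ ys (subst (_∈ _) eq (∈-map⁺ (Inverse.to π) z∈))))) ∈ys)

module Order (em : ExcludedMiddle 0ℓ) (𝓕 : Signature) (V : Set)
             (_>_ : Rel (Rewriting.Term 𝓕 V) 0ℓ)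
             (reductionOrder : Rewriting.IsReductionOrder 𝓕 V _>_) where

  open Rewriting 𝓕 V
  open Terms 𝓕 V
  open Classical em 𝓕 V
  open OrderedCompletion _>_
  open IsReductionOrder reductionOrder
  private module O = IsStrictPartialOrder isStrictPartialOrder

  -- Consequences of a reduction order.

  >-irrefl : ∀ {t} → ¬ t > t
  >-irrefl = O.irrefl refl

  >-asym : ∀ {s t} → s > t → ¬ t > s
  >-asym s>t t>s = >-irrefl (O.trans s>t t>s)

  >-Inst : ∀ {l r s t} → l > r → Inst l r s t → s > t
  >-Inst l>r (inst C σ refl refl) = closedContext C (closedSubst σ l>r)

  >-Step : ∀ {X : ES} → (∀ {l r} → X l r → l > r) → ∀ {s t} → Step X s t → s > t
  >-Step X⊆> (step Xlr C σ) = closedContext C (closedSubst σ (X⊆> Xlr))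

  -- Wrapping in `C` repeatedly would give an infinite descent from `t`.
  ≯⟦⟧ : ∀ {t} C → ¬ t > (C ⟦ t ⟧)
  ≯⟦⟧ {t} C = go (wellFounded t)
    where
    go : ∀ {t} → Acc (flip _>_) t → ¬ t > (C ⟦ t ⟧)
    go (acc rs) t>Ct = go (rs t>Ct) (closedContext C t>Ct)

  -- If `x` occurred in `r` only, substituting `l` for it would make `l` greater than a term
  -- containing `l`.
  >⇒∈ᵛ : ∀ {l r} → l > r → ∀ x → x ∈ᵛ r → x ∈ᵛ l
  >⇒∈ᵛ {l} {r} l>r x x∈r with em {x ∈ᵛ l}
  ... | yes x∈l = x∈l
  ... | no x∉l with C , refl ← ∈ᵛ⇒⟦⟧ x∈r =
    contradiction (subst₂ _>_ ([↦]-fresh l l x∉l)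
                     (trans (⟦⟧-· C) (cong ((C ·ᶜ [ x ↦ l ]) ⟦_⟧) ([↦]-self var x l)))
                     (closedSubst [ x ↦ l ] l>r))
                  (≯⟦⟧ (C ·ᶜ [ x ↦ l ]))

  -- If the variable occurs in `r`, it is greater than a term containing it; if not, substituting
  -- `r` for it yields `r > r`.
  >⇒nonVar : ∀ {l r} → l > r → ¬ IsVar l
  >⇒nonVar {r = r} x>r (var x) with em {x ∈ᵛ r}
  ... | yes x∈r with C , refl ← ∈ᵛ⇒⟦⟧ x∈r = ≯⟦⟧ C x>r
  ... | no x∉r  = >-irrefl (subst₂ _>_ ([↦]-self var x r) ([↦]-fresh r r x∉r) (closedSubst [ x ↦ r ] x>r))

  ⊆>⇒isTRS : ∀ {X : ES} → (∀ {l r} → X l r → l > r) → IsTRS X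
  ⊆>⇒isTRS X⊆> Xlr = >⇒nonVar (X⊆> Xlr) , >⇒∈ᵛ (X⊆> Xlr)

  ⊆>⇒terminating : ∀ {X : ES} → (∀ {l r} → X l r → l > r) → WellFounded (flip (Step X))
  ⊆>⇒terminating X⊆> = Subrelation.wellFounded (>-Step X⊆>) wellFounded

  Within : (Term → Set) → ES → Rel Term 0ℓ
  Within P X s t = Step X s t × P s × P t

  -- Both ends of every step lie in `P`; the empty conversion demands nothing of its term.
  ConversionIn : (Term → Set) → ES → Rel Term 0ℓ
  ConversionIn P X = EqClosure (Within P X)

  module _ {P : Term → Set} {X : ES} (X⊆> : ∀ {l r} → X l r → l > r)
           (P-closed : ∀ {s t} → P s → s > t → P t) where

    Star⇒ConversionIn : ∀ {s t} → P s → Star (Step X) s t → ConversionIn P X s t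
    Star⇒ConversionIn Ps ε          = ε
    Star⇒ConversionIn Ps (st ◅ sts) =
      fwd (st , Ps , Pt) ◅ Star⇒ConversionIn Pt sts
      where Pt = P-closed Ps (>-Step X⊆> st)

    Joinable⇒ConversionIn : ∀ {s t} → P s → P t → Joinable X s t → ConversionIn P X s t
    Joinable⇒ConversionIn Ps Pt (_ , su , tu) =
      Star⇒ConversionIn Ps su ◅◅ Eq.symmetric _ (Star⇒ConversionIn Pt tu)

  -- Replacing rules and equations that do not persist.

  module Fates (E∞ R∞ Rω : ES) where

    Pairs : ES
    Pairs = R∞ ∪ E∞ ±

    -- Covers rule steps and ordered equation steps alike. The order is required between the
    -- endpoints of the step, not between the instances of `l` and `r`.
    data Reduct (s u : Term) : Set where
      reduct : ∀ l r → Pairs l r → Inst l r s u → s > u → Reduct s u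

    data Reduct▷ (s u : Term) : Set where
      reduct : ∀ l r → Pairs l r → Inst l r s u → s > u → ProperlyEncompasses s l → Reduct▷ s u

    data FateR (l r : Term) : Set where
      persists  : Rω l r → FateR l r
      composed  : ∀ {u} → R∞ l u → Reduct r u → FateR l r
      collapsed : ∀ {u} → (E∞ ±) u r → Reduct▷ l u → FateR l r

    data FateE (s t : Term) : Set where
      orientedˡ   : R∞ s t → FateE s t
      orientedʳ   : R∞ t s → FateE s t
      trivial     : s ≡ t → FateE s t
      simplifiedˡ : ∀ {u} → (E∞ ±) u t → Step R∞ s u ⊎ Reduct▷ s u → FateE s t
      simplifiedʳ : ∀ {u} → (E∞ ±) s u → Step R∞ t u ⊎ Reduct▷ t u → FateE s t

    FateE-sym : ∀ {s t} → FateE s t → FateE t s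
    FateE-sym (orientedˡ R)     = orientedʳ R
    FateE-sym (orientedʳ R)     = orientedˡ R
    FateE-sym (trivial eq)      = trivial (sym eq)
    FateE-sym (simplifiedˡ E s) = simplifiedʳ (swap E) s
    FateE-sym (simplifiedʳ E s) = simplifiedˡ (swap E) s

    module Persistence
      (R∞⊆> : ∀ {l r} → R∞ l r → l > r)
      (fateR : ∀ {l r} → R∞ l r → FateR l r)
      (fateE : ∀ {s t} → (E∞ ±) s t → FateE s t)
      (P : Term → Set) (P-closed : ∀ {s t} → P s → s > t → P t)
      where

      infix 4 _≃_

      _≃_ : Rel Term 0ℓ
      _≃_ = ConversionIn P Rω

      ≃-sym : ∀ {s t} → s ≃ t → t ≃ s
      ≃-sym = Eq.symmetric _

      Replaceable : Term → Set
      Replaceable s = P s → ∀ {l r t} → Pairs l r → Inst l r s t → s > t → s ≃ t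

      reduct-≃ : ∀ {s u} → Replaceable s → P s → Reduct s u → s ≃ u
      reduct-≃ rep Ps (reduct _ _ lr i s>u) = rep Ps lr i s>u

      Reduct-closed : ∀ {s u} C σ → Reduct s u → Reduct (C ⟦ s · σ ⟧) (C ⟦ u · σ ⟧)
      Reduct-closed C σ (reduct l r lr i s>u) =
        reduct l r lr (Inst-closed C σ i) (closedContext C (closedSubst σ s>u))

      simplification⇒Reduct : ∀ {s u} → Step R∞ s u ⊎ Reduct▷ s u → Reduct s u
      simplification⇒Reduct (inj₁ st) with l , r , lr , i ← Step⇒Inst st =
        reduct l r (inj₁ lr) i (>-Inst (R∞⊆> lr) i)
      simplification⇒Reduct (inj₂ (reduct l r lr i s>u _)) = reduct l r lr i s>u

      reduct-> : ∀ {s u} → Reduct s u → s > u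
      reduct-> (reduct _ _ _ _ s>u) = s>u

      -- Simplification lowers one endpoint and keeps the other, so the induction is on both. `B`
      -- collects terms whose decreasing steps are already replaceable: the terms below `s` inside
      -- the main induction, and all terms after it.
      equation-≃ : (B : Term → Set) → (∀ {s t} → B s → s > t → B t) → (∀ {s} → B s → Replaceable s) →
                   ∀ {x y} → Acc (flip _>_) x → Acc (flip _>_) y → B x → B y → P x → P y →
                   ∀ {l r} → (E∞ ±) l r → Inst l r x y → x ≃ y
      equation-≃ B B-closed rep {x} {y} (acc rsx) (acc rsy) Bx By Px Py lr (inst C σ refl refl)
        with fateE lr
      ... | orientedˡ R    = rep Bx Px (inj₁ R) i (>-Inst (R∞⊆> R) i)
        where i = inst C σ refl refl
      ... | orientedʳ R    = ≃-sym (rep By Py (inj₁ R) i (>-Inst (R∞⊆> R) i))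
        where i = inst C σ refl refl
      ... | trivial refl   = ε
      ... | simplifiedˡ ur l→u =
        reduct-≃ (rep Bx) Px x→z ◅◅
        equation-≃ B B-closed rep (rsx x>z) (acc rsy) (B-closed Bx x>z) By (P-closed Px x>z) Py
                   ur (inst C σ refl refl)
        where
        x→z = Reduct-closed C σ (simplification⇒Reduct l→u)
        x>z = reduct-> x→z
      ... | simplifiedʳ lu r→u =
        equation-≃ B B-closed rep (acc rsx) (rsy y>z) Bx (B-closed By y>z) Px (P-closed Py y>z)
                   lu (inst C σ refl refl) ◅◅
        ≃-sym (reduct-≃ (rep By) Py y→z)
        where
        y→z = Reduct-closed C σ (simplification⇒Reduct r→u)
        y>z = reduct-> y→z

      module _ {s} (rep : ∀ {x} → s > x → Replaceable x) (Ps : P s) where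

        -- The induction hypothesis on left-hand sides, for steps from the fixed term `s`.
        Below : Term → Set
        Below l = ∀ {l′ r t} → ProperlyEncompasses l l′ → Pairs l′ r → Inst l′ r s t → s > t → s ≃ t

        Below-⊵ : ∀ l l′ → Encompasses l l′ → Below l → Below l′
        Below-⊵ l l′ l⊵l′ below {l″} l′▷l″ = below (⊵-▷-trans l l′ l″ l⊵l′ l′▷l″)

        reduct▷-≃ : ∀ {l u} → Below l → ∀ C σ → s ≡ C ⟦ l · σ ⟧ → Reduct▷ l u → s ≃ C ⟦ u · σ ⟧
        reduct▷-≃ below C σ refl (reduct _ _ lr i l>u l▷l′) =
          below l▷l′ lr (Inst-closed C σ i) (closedContext C (closedSubst σ l>u))

        smaller-≃ : ∀ {x y l r} → s > x → s > y → (E∞ ±) l r → Inst l r x y → x ≃ y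
        smaller-≃ {x} {y} s>x s>y = equation-≃ (s >_) O.trans rep (wellFounded x) (wellFounded y)
          s>x s>y (P-closed Ps s>x) (P-closed Ps s>y)

        target-≃ : ∀ {r u} C σ → s > (C ⟦ r · σ ⟧) → Reduct r u → C ⟦ u · σ ⟧ ≃ C ⟦ r · σ ⟧
        target-≃ C σ s>t r→u =
          ≃-sym (reduct-≃ (rep s>t) (P-closed Ps s>t) (Reduct-closed C σ r→u))

        -- Induction on `r`. Composition keeps `l` and lowers `r`, and the step between the two
        -- right-hand sides starts below `s`. Collapse uses a left-hand side properly encompassed by
        -- `l`, which `below` covers, and leaves an equation step between terms below `s`.
        rule-≃ : ∀ {l r t} → Below l → Acc (flip _>_) r → R∞ l r → Inst l r s t → s ≃ t
        rule-≃ below (acc rs) lr i@(inst C σ refl refl) with fateR lr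
        ... | persists R = fwd (step R C σ , Ps , P-closed Ps (>-Inst (R∞⊆> lr) i)) ◅ ε
        ... | composed lu r→u =
          rule-≃ below (rs (reduct-> r→u)) lu (inst C σ refl refl) ◅◅
          target-≃ C σ (>-Inst (R∞⊆> lr) i) r→u
        ... | collapsed ur l→u@(reduct _ _ _ _ l>u _) =
          reduct▷-≃ below C σ refl l→u ◅◅
          smaller-≃ (closedContext C (closedSubst σ l>u)) (>-Inst (R∞⊆> lr) i)
                    ur (inst C σ refl refl)

        -- Simplifying the right-hand side lowers `r`; simplifying the left-hand side leaves an
        -- equation step between terms below `s`. Orientation passes the step to `rule-≃`, and the
        -- opposite orientation contradicts `s > t`.
        oriented-≃ : ∀ {l r t} → Below l → Acc (flip _>_) r → (E∞ ±) l r → Inst l r s t → s > t → s ≃ t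
        oriented-≃ {l} below (acc rs) lr i@(inst C σ refl refl) s>t with fateE lr
        ... | orientedˡ R  = rule-≃ below (wellFounded _) R i
        ... | orientedʳ R  = contradiction (>-Inst (R∞⊆> R) (inst C σ refl refl)) (>-asym s>t)
        ... | trivial refl = ε
        ... | simplifiedˡ ur (inj₁ l→u) with l′ , r′ , lr′ , i′ ← Step⇒Inst l→u =
          -- Here `l` need not encompass `l′` properly. The descent is from equations to rules, and
          -- the hypothesis `below` carries over from `l` to `l′`.
          rule-≃ (Below-⊵ l l′ (Inst⇒Encompasses i′) below) (wellFounded r′) lr′ (Inst-closed C σ i′) ◅◅
          smaller-≃ (closedContext C (closedSubst σ (>-Step R∞⊆> l→u))) s>t ur (inst C σ refl refl)
        ... | simplifiedˡ ur (inj₂ l→u@(reduct _ _ _ _ l>u _)) =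
          reduct▷-≃ below C σ refl l→u ◅◅
          smaller-≃ (closedContext C (closedSubst σ l>u)) s>t ur (inst C σ refl refl)
        ... | simplifiedʳ {u} lu r→u =
          oriented-≃ below (rs r>u) lu (inst C σ refl refl)
            (O.trans s>t (closedContext C (closedSubst σ r>u))) ◅◅
          target-≃ C σ s>t (simplification⇒Reduct r→u)
          where r>u = reduct-> (simplification⇒Reduct r→u)

        step-≃ : ∀ {l r t} → Acc (flip ProperlyEncompasses) l → Pairs l r → Inst l r s t → s > t → s ≃ t
        step-≃ {l} {r} (acc rs) lr i s>t = [ (λ R → rule-≃ below (wellFounded r) R i) ,
                                             (λ E → oriented-≃ below (wellFounded r) E i s>t) ]′ lr
          where
          below : Below l
          below l▷l′ lr′ i′ s>t′ = step-≃ (rs l▷l′) lr′ i′ s>t′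

      replaceable : ∀ s → Replaceable s
      replaceable s = go (wellFounded s)
        where
        go : ∀ {s} → Acc (flip _>_) s → Replaceable s
        go (acc rs) Ps {l} lr i s>t =
          step-≃ (λ s>x → go (rs s>x)) Ps (properlyEncompasses-wellFounded l) lr i s>t

      E∞-≃ : ∀ {x y} → P x → P y → Step E∞ x y → x ≃ y
      E∞-≃ {x} {y} Px Py st with l , r , lr , i ← Step⇒Inst st =
        -- All terms are replaceable by now, so `B` can be trivial.
        equation-≃ (λ _ → ⊤) _ (λ {s} _ → replaceable s) (wellFounded x) (wellFounded y)
                   tt tt Px Py (inj₁ lr) i

  -- Confluence from connected peaks.

  module _ {X : ES} (X⊆> : ∀ {l r} → X l r → l > r) where

    ConfluentAt : Term → Set
    ConfluentAt s = ∀ {t u} → Star (Step X) s t → Star (Step X) s u → Joinable X t u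

    -- Induction along the conversion: a backward step creates a peak at a term of `P`, where
    -- confluence is available.
    churchRosser-in : ∀ {P} → (∀ {t} → P t → ConfluentAt t) →
                      ∀ {s t} → ConversionIn P X s t → Joinable X s t
    churchRosser-in conf ε                     = _ , ε , ε
    churchRosser-in conf (fwd (st , _ , _) ◅ c) with _ , tv , uv ← churchRosser-in conf c =
      _ , st ◅ tv , uv
    churchRosser-in conf (bwd (ts , Pt , _) ◅ c) with _ , tv , uv ← churchRosser-in conf c
                                                 with _ , sw , vw ← conf Pt (ts ◅ ε) tv =
      _ , sw , uv ◅◅ vw

    -- Newman's lemma with joinability of local peaks weakened to connectedness. The connecting
    -- terms are below `s`, hence confluent by induction, so the connecting conversion becomes a
    -- joining.
    connected⇒confluent : (∀ {s t u} → Step X s t → Step X s u → ConversionIn (s >_) X t u) →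
                          ∀ s → ConfluentAt s
    connected⇒confluent connected s = go (wellFounded s)
      where
      go : ∀ {s} → Acc (flip _>_) s → ConfluentAt s
      go _        ε         b = _ , b , ε
      go _        (st ◅ a)  ε = _ , ε , st ◅ a
      go (acc rs) (st ◅ a) (su ◅ b)
        with _ , tv , uv ← churchRosser-in (λ s>x → go (rs s>x)) (connected st su)
        with _ , t′w , vw ← go (rs (>-Step X⊆> st)) a tv
        with _ , wz , u′z ← go (rs (>-Step X⊆> su)) (uv ◅◅ vw) b =
        _ , t′w ◅◅ wz , u′z

  -- Connectedness of peaks.

  ConversionIn-⟦⟧ : ∀ {X s t u} C → ConversionIn (s >_) X t u →
                    ConversionIn ((C ⟦ s ⟧) >_) X (C ⟦ t ⟧) (C ⟦ u ⟧)
  ConversionIn-⟦⟧ C = Eq.gmap (C ⟦_⟧) λ (st , s>t , s>u) →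
    Step-⟦⟧ C st , closedContext C s>t , closedContext C s>u

  -- The analogue of `IsPrime` in terms of contexts, which, unlike positions, can be instantiated
  -- directly.
  ProperSubtermsNormal : ES → Term → Set
  ProperSubtermsNormal X t = ∀ E u → E ≢ □ → t ≡ E ⟦ u ⟧ → IsNormalForm (Step X) u

  -- Normality of the proper subterms of l₁τ excludes redexes below the root of
  -- l₁τ and makes the critical pair prime.
  module CriticalPeaks
    (inf : Infinite V) {X Y : ES}
    (X⊆> : ∀ {l r} → X l r → l > r) (X⊆Y : X ⇒ Y) (Y^>⊆X : Step (Y ^>) ⇒ Step X)
    (pcp-connected : ∀ {t u} → PCP Y t u → ∀ δ {s} → s > (t · δ) → s > (u · δ) →
                     ConversionIn (s >_) X (t · δ) (u · δ))
    where

    open Locate X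

    variant-> : ∀ {l r} → VariantIn X l r → l > r
    variant-> (_ , _ , Xlr , π , refl , refl) = closedSubst (rename π) (X⊆> Xlr)

    -- At a non-variable position `τ` factors as `μ` followed by `δ`, and the peak is the
    -- `δ`-instance of a prime critical pair. Inside the value of a variable, the peak is joined by
    -- rewriting all occurrences of that variable.
    overlap-connected : ∀ {l₁ r₁ l₂ r₂ τ} E →
      VariantIn X l₁ r₁ → X l₂ r₂ →
      (∀ x → x ∈ᵛ l₁ ⊎ x ∈ᵛ r₁ → ¬ (x ∈ᵛ l₂ ⊎ x ∈ᵛ r₂)) →
      l₂ · τ ≡ E ⟦ l₁ · τ ⟧ → ProperSubtermsNormal X (l₁ · τ) →
      ConversionIn ((l₂ · τ) >_) X (E ⟦ r₁ · τ ⟧) (r₂ · τ)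
    overlap-connected {l₁} {r₁} {l₂} {r₂} {τ} E
      variant@(l , r , Xlr , π , refl , refl) Xl₂r₂ disj eq normal with locate E l₂ (sym eq)
    ... | at p nonVar unif replace
      with μ , mgu ← unifiable⇒mgu {l₁} {l₂ ∣ p} (sym unif)
      with δ , τ≗μδ ← proj₂ mgu τ (sym unif) =
      subst₂ (ConversionIn ((l₂ · τ) >_) X) left right
        (pcp-connected
          (pcp {p = p} record
            { variant₁ = l , r , inj₁ (X⊆Y Xlr) , π , refl , refl
            ; variant₂ = l₂ , r₂ , inj₁ (X⊆Y Xl₂r₂) , ↔-id V , sym (·-id l₂) , sym (·-id r₂)
            ; disjoint = disj
            ; nonVar   = nonVar
            ; mgu      = mgu
            ; r₁≯l₁    = >-asym (closedSubst μ (variant-> variant))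
            ; r₂≯l₂    = >-asym (closedSubst μ (X⊆> Xl₂r₂))
            } prime)
          δ
          (subst₂ _>_ (sym eq) (sym left) (closedContext E (closedSubst τ (variant-> variant))))
          (subst ((l₂ · τ) >_) (sym right) (closedSubst τ (X⊆> Xl₂r₂))))
      where
      factor : ∀ t → t · μ · δ ≡ t · τ
      factor t = trans (sym (·-⊙ t μ δ)) (sym (·-cong t λ x _ → τ≗μδ x))

      left : (l₂ [ p ]≔ r₁) · μ · δ ≡ E ⟦ r₁ · τ ⟧
      left = trans (factor (l₂ [ p ]≔ r₁)) (replace r₁)

      right : r₂ · μ · δ ≡ r₂ · τ
      right = factor r₂

      -- An ordered step in a proper subterm of `l₁ · μ` would become, under `δ`, an `X`-step in a
      -- proper subterm of `l₁ · τ`.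
      prime : IsPrime Y (l₁ · μ)
      prime q q≢ε (_ , st) with C , eq′ , C≢□ ← subterm-context (l₁ · μ) q =
        normal (C ·ᶜ δ) _ (·ᶜ-nonRoot {C} (C≢□ q≢ε))
          (trans (sym (factor l₁)) (trans (cong (_· δ) eq′) (⟦⟧-· C)))
          (_ , Step-closed □ δ (Y^>⊆X st))
    ... | below x C τx≡ rejoin =
      Joinable⇒ConversionIn X⊆> O.trans
        (subst (_> _) (sym eq) (closedContext E (closedSubst τ (variant-> variant))))
        (closedSubst τ (X⊆> Xl₂r₂))
        (r₂ · τ′ ,
         rejoin ([↦]-self τ x _) τ→τ′ ◅◅ step Xl₂r₂ □ τ′ ◅ ε ,
         Star-· r₂ τ→τ′)
      where
      -- The inner redex is contracted once in the value of `x`, hence at every occurrence of `x` in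
      -- `l₂` and `r₂`.
      τ′ : Subst
      τ′ = τ ⟨ x ↦ C ⟦ r₁ · τ ⟧ ⟩

      τ→τ′ : ∀ y → Star (Step X) (τ y) (τ′ y)
      τ→τ′ y with em {y ≡ x}
      ... | yes refl = subst (λ t → Step X t _) (sym τx≡)
                         (Step-⟦⟧ C (subst₂ (Step X) (·-⊙ l (rename π) τ) (·-⊙ r (rename π) τ)
                                       (step Xlr □ (rename π ⊙ τ)))) ◅ ε
      ... | no _     = ε

    -- Renaming the inner rule apart from the outer one allows `σ₁` and `σ₂` to be merged into a
    -- single `τ`.
    root-connected : ∀ {l₁ r₁ l₂ r₂ σ₁ σ₂} E → X l₁ r₁ → X l₂ r₂ →
      l₂ · σ₂ ≡ E ⟦ l₁ · σ₁ ⟧ → ProperSubtermsNormal X (l₁ · σ₁) →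
      ConversionIn ((l₂ · σ₂) >_) X (E ⟦ r₁ · σ₁ ⟧) (r₂ · σ₂)
    root-connected {l₁} {r₁} {l₂} {r₂} {σ₁} {σ₂} E Xl₁r₁ Xl₂r₂ eq normal
      with π , apart ← rename-apart inf (vars l₁ ++ vars r₁) (vars l₂ ++ vars r₂) =
      subst₂ (λ a b → ConversionIn (a >_) X (E ⟦ r₁ · σ₁ ⟧) b) l₂τ r₂τ
        (subst (λ a → ConversionIn ((l₂ · τ) >_) X (E ⟦ a ⟧) (r₂ · τ)) r₁τ
          (overlap-connected E (l₁ , r₁ , Xl₁r₁ , π , refl , refl) Xl₂r₂ disj
            (trans l₂τ (trans eq (cong (E ⟦_⟧) (sym l₁τ))))
            (subst (ProperSubtermsNormal X) (sym l₁τ) normal)))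
      where
      open Inverse π using (to; from; strictlyInverseʳ)

      Left : V → Set
      Left x = x ∈ᵛ l₁ · rename π ⊎ x ∈ᵛ r₁ · rename π

      τ : Subst
      τ x with em {Left x}
      ... | yes _ = σ₁ (from x)
      ... | no _  = σ₂ x

      image : ∀ {x} → Left x → ∃[ y ] y ∈ vars l₁ ++ vars r₁ × x ≡ to y
      image (inj₁ x∈)
        with y , y∈ , eq ← ∈-map⁻ to (subst (_ ∈_) (vars-map l₁ to) (∈ᵛ⇒∈ x∈)) = y , ∈-++⁺ˡ y∈ , eq
      image (inj₂ x∈)
        with y , y∈ , eq ← ∈-map⁻ to (subst (_ ∈_) (vars-map r₁ to) (∈ᵛ⇒∈ x∈)) =
        y , ∈-++⁺ʳ (vars l₁) y∈ , eq

      disj : ∀ x → Left x → ¬ (x ∈ᵛ l₂ ⊎ x ∈ᵛ r₂)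
      disj x left right with y , y∈ , refl ← image left =
        apart y∈ ([ ∈-++⁺ˡ ∘ ∈ᵛ⇒∈ , ∈-++⁺ʳ (vars l₂) ∘ ∈ᵛ⇒∈ ]′ right)

      τ-left : ∀ x → Left x → τ x ≡ σ₁ (from x)
      τ-left x left with em {Left x}
      ... | yes _    = refl
      ... | no ¬left = contradiction left ¬left

      τ-right : ∀ x → x ∈ᵛ l₂ ⊎ x ∈ᵛ r₂ → τ x ≡ σ₂ x
      τ-right x right with em {Left x}
      ... | yes left = contradiction right (disj x left)
      ... | no _     = refl

      unrename : ∀ t → t · rename π · (σ₁ ∘ from) ≡ t · σ₁
      unrename t = trans (sym (·-⊙ t (rename π) (σ₁ ∘ from)))
                         (·-cong t λ x _ → cong σ₁ (strictlyInverseʳ x))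

      l₁τ : l₁ · rename π · τ ≡ l₁ · σ₁
      l₁τ = trans (·-cong (l₁ · rename π) λ x → τ-left x ∘ inj₁) (unrename l₁)

      r₁τ : r₁ · rename π · τ ≡ r₁ · σ₁
      r₁τ = trans (·-cong (r₁ · rename π) λ x → τ-left x ∘ inj₂) (unrename r₁)

      l₂τ : l₂ · τ ≡ l₂ · σ₂
      l₂τ = ·-cong l₂ λ x → τ-right x ∘ inj₁

      r₂τ : r₂ · τ ≡ r₂ · σ₂
      r₂τ = ·-cong r₂ λ x → τ-right x ∘ inj₂

    -- A redex containing the innermost one reduces to `root-connected`, a redex strictly inside it
    -- is excluded by normality, and parallel steps commute.
    innermost-connected : ∀ {l r t u} C σ → X l r → ProperSubtermsNormal X (l · σ) →
      t ≡ C ⟦ l · σ ⟧ → Step X t u → ConversionIn (t >_) X (C ⟦ r · σ ⟧) u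
    innermost-connected {l} {r} C σ Xlr normal eq (step {l₂} {r₂} Xl₂r₂ D τ)
      with compare X C D (sym eq)
    ... | inside E refl eq′ =
      subst (λ a → ConversionIn _ X a _) (sym (∘ᶜ-⟦⟧ D))
        (ConversionIn-⟦⟧ D (root-connected E Xlr Xl₂r₂ eq′ normal))
    ... | outside E E≢□ eq′ = contradiction (_ , step Xl₂r₂ □ τ) (normal E _ E≢□ eq′)
    ... | parallel commute with w , b→ , a→ ← commute (r · σ) (r₂ · τ) =
      Joinable⇒ConversionIn X⊆> O.trans
        (subst (_> _) (sym eq) (closedContext C (closedSubst σ (X⊆> Xlr))))
        (closedContext D (closedSubst τ (X⊆> Xl₂r₂)))
        (w , b→ (step Xl₂r₂ □ τ) ◅ ε , a→ (step Xlr □ σ) ◅ ε)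

    -- Descend into a reducible proper subterm as long as there is one. When there is none, the
    -- given step must be at the root.
    innermost : ∀ {s t} → Step X s t →
                ∃[ C ] ∃[ l ] ∃[ r ] ∃[ σ ] X l r × ProperSubtermsNormal X (l · σ) × s ≡ C ⟦ l · σ ⟧
    innermost {s} st = go (<-wellFounded (size s)) st
      where
      ReducibleBelow : Term → Set
      ReducibleBelow s = ∃[ C ] ∃[ t ] C ≢ □ × s ≡ C ⟦ t ⟧ × ∃[ u ] Step X t u

      go : ∀ {s t} → Acc _<_ (size s) → Step X s t →
           ∃[ C ] ∃[ l ] ∃[ r ] ∃[ σ ] X l r × ProperSubtermsNormal X (l · σ) × s ≡ C ⟦ l · σ ⟧
      go {s} (acc rs) st with em {ReducibleBelow s}
      ... | yes (C , t , C≢□ , refl , _ , st′) with size-⟦⟧ C t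
      ...   | inj₁ C≡□ = contradiction C≡□ C≢□
      ...   | inj₂ lt with D , l , r , σ , Xlr , normal , refl ← go (rs lt) st′ =
        C ∘ᶜ D , l , r , σ , Xlr , normal , sym (∘ᶜ-⟦⟧ C)
      go (acc rs) (step Xlr □ σ) | no ∄ =
        □ , _ , _ , σ , Xlr , (λ C u C≢□ eq red → ∄ (C , u , C≢□ , eq , red)) , refl
      go (acc rs) (step Xlr C@(fun _ _) σ) | no ∄ =
        contradiction (C , _ , (λ ()) , refl , _ , step Xlr □ σ) ∄

    -- Any peak splits into two peaks that involve a common innermost step.
    peak-connected : ∀ {s t u} → Step X s t → Step X s u → ConversionIn (s >_) X t u
    peak-connected st su with C , l , r , σ , Xlr , normal , eq ← innermost st =
      Eq.symmetric _ (innermost-connected C σ Xlr normal eq st) ◅◅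
      innermost-connected C σ Xlr normal eq su

  -- Soundness of the inference rules and orientation of the rewrite rules.

  Conversion-closed : ∀ {X : ES} {s t} C σ → Conversion X s t →
                      Conversion X (C ⟦ s · σ ⟧) (C ⟦ t · σ ⟧)
  Conversion-closed C σ = Eq.gmap (λ t → C ⟦ t · σ ⟧) (Step-closed C σ)

  pair⇒Step : ∀ {X : ES} {l r} → X l r → Step X l r
  pair⇒Step {l = l} {r} Xlr = subst₂ (Step _) (·-id l) (·-id r) (step Xlr □ var)

  pair⇒Conversion : ∀ {X : ES} {l r} → X l r → Conversion X l r
  pair⇒Conversion Xlr = fwd (pair⇒Step Xlr) ◅ ε

  ⊆Conversion⇒Step⊆Conversion : ∀ {X Y : ES} → X ⇒ Conversion Y → Step X ⇒ Conversion Y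
  ⊆Conversion⇒Step⊆Conversion X⊆Y (step Xlr C σ) = Conversion-closed C σ (X⊆Y Xlr)

  ⊆Conversion⇒Conversion⊆ : ∀ {X Y : ES} → X ⇒ Conversion Y → Conversion X ⇒ Conversion Y
  ⊆Conversion⇒Conversion⊆ X⊆Y = Eq.fold (Eq.isEquivalence _) (⊆Conversion⇒Step⊆Conversion X⊆Y)

  StepE▷⇒Conversion : ∀ {E s t} → StepE▷ E s t → Conversion E s t
  StepE▷⇒Conversion (step (inj₁ lr) C σ _ _) = fwd (step lr C σ) ◅ ε
  StepE▷⇒Conversion (step (inj₂ rl) C σ _ _) = bwd (step rl C σ) ◅ ε

  StepR▷⇒Step : ∀ {R s t} → StepR▷ R s t → Step R s t
  StepR▷⇒Step (step lr C σ _) = step lr C σ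

  ±⊆Conversion : ∀ {E} → (E ±) ⇒ Conversion E
  ±⊆Conversion (inj₁ st) = pair⇒Conversion st
  ±⊆Conversion (inj₂ ts) = Eq.symmetric _ (pair⇒Conversion ts)

  ^>⊆Conversion : ∀ {E} → (E ^>) ⇒ Conversion E
  ^>⊆Conversion (_ , _ , σ , lr , refl , refl , _) = Conversion-closed □ σ (±⊆Conversion lr)

  ^>⊆> : ∀ {E s t} → (E ^>) s t → s > t
  ^>⊆> (_ , _ , _ , _ , refl , refl , s>t) = s>t

  Both : ES × ES → ES
  Both (E , R) = E ∪ R

  module _ {E R : ES} where

    private
      fromE : Conversion E ⇒ Conversion (E ∪ R)
      fromE = Eq.map (Step-map inj₁)

      fromR : Conversion R ⇒ Conversion (E ∪ R)
      fromR = Eq.map (Step-map inj₂)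

    simplification⊆Conversion : ∀ {s t} → Step R s t ⊎ StepE▷ E s t → Conversion (E ∪ R) s t
    simplification⊆Conversion (inj₁ st) = fromR (Eq.return st)
    simplification⊆Conversion (inj₂ st) = fromE (StepE▷⇒Conversion st)

    reduction⊆Conversion : ∀ {s t} → Step (E ^> ∪ R) s t → Conversion (E ∪ R) s t
    reduction⊆Conversion = ⊆Conversion⇒Step⊆Conversion
      [ (λ st → fromE (^>⊆Conversion st)) , (λ st → fromR (pair⇒Conversion st)) ]′

    deduction⊆Conversion : ∀ {s t} → Step (R ∪ E ±) s t → Conversion (E ∪ R) s t
    deduction⊆Conversion = ⊆Conversion⇒Step⊆Conversion
      [ (λ st → fromR (pair⇒Conversion st)) , (λ st → fromE (±⊆Conversion st)) ]′

  -- This leads from `R ω` back to `E 0`. The other inclusion has to end in persistent rules and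
  -- comes from the fates.
  ⊢ʳ-sound : ∀ {A B} → A ⊢ʳ B → Both B ⇒ Conversion (Both A)
  ⊢ʳ-sound (deduce us ut) (inj₁ (inj₁ e)) = pair⇒Conversion (inj₁ e)
  ⊢ʳ-sound (deduce us ut) (inj₁ (inj₂ (refl , refl))) =
    Eq.symmetric _ (deduction⊆Conversion us) ◅◅ deduction⊆Conversion ut
  ⊢ʳ-sound (deduce us ut) (inj₂ r) = pair⇒Conversion (inj₂ r)
  ⊢ʳ-sound (orientˡ _ _) (inj₁ e) = pair⇒Conversion (inj₁ (inj₁ e))
  ⊢ʳ-sound (orientˡ _ _) (inj₂ (inj₁ r)) = pair⇒Conversion (inj₂ r)
  ⊢ʳ-sound (orientˡ _ _) (inj₂ (inj₂ (refl , refl))) = pair⇒Conversion (inj₁ (inj₂ (refl , refl)))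
  ⊢ʳ-sound (orientʳ _ _) (inj₁ e) = pair⇒Conversion (inj₁ (inj₁ e))
  ⊢ʳ-sound (orientʳ _ _) (inj₂ (inj₁ r)) = pair⇒Conversion (inj₂ r)
  ⊢ʳ-sound (orientʳ _ _) (inj₂ (inj₂ (refl , refl))) =
    Eq.symmetric _ (pair⇒Conversion (inj₁ (inj₂ (refl , refl))))
  ⊢ʳ-sound (delete _) (inj₁ e) = pair⇒Conversion (inj₁ (inj₁ e))
  ⊢ʳ-sound (delete _) (inj₂ r) = pair⇒Conversion (inj₂ r)
  ⊢ʳ-sound (compose _ _) (inj₁ e) = pair⇒Conversion (inj₁ e)
  ⊢ʳ-sound (compose _ _) (inj₂ (inj₁ r)) = pair⇒Conversion (inj₂ (inj₁ r))
  ⊢ʳ-sound (compose _ tu) (inj₂ (inj₂ (refl , refl))) =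
    pair⇒Conversion (inj₂ (inj₂ (refl , refl))) ◅◅
    reduction⊆Conversion (Step-map [ inj₁ , inj₂ ∘ inj₁ ]′ tu)
  ⊢ʳ-sound (simplifyˡ _ _) (inj₁ (inj₁ e)) = pair⇒Conversion (inj₁ (inj₁ e))
  ⊢ʳ-sound (simplifyˡ _ su) (inj₁ (inj₂ (refl , refl))) =
    Eq.symmetric _ (Eq.map (Step-map [ inj₁ ∘ inj₁ , inj₂ ]′) (simplification⊆Conversion su)) ◅◅
    pair⇒Conversion (inj₁ (inj₂ (refl , refl)))
  ⊢ʳ-sound (simplifyˡ _ _) (inj₂ r) = pair⇒Conversion (inj₂ r)
  ⊢ʳ-sound (simplifyʳ _ _) (inj₁ (inj₁ e)) = pair⇒Conversion (inj₁ (inj₁ e))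
  ⊢ʳ-sound (simplifyʳ _ tu) (inj₁ (inj₂ (refl , refl))) =
    pair⇒Conversion (inj₁ (inj₂ (refl , refl))) ◅◅
    Eq.map (Step-map [ inj₁ ∘ inj₁ , inj₂ ]′) (simplification⊆Conversion tu)
  ⊢ʳ-sound (simplifyʳ _ _) (inj₂ r) = pair⇒Conversion (inj₂ r)
  ⊢ʳ-sound (collapse _ _) (inj₁ (inj₁ e)) = pair⇒Conversion (inj₁ e)
  ⊢ʳ-sound (collapse _ tu) (inj₁ (inj₂ (refl , refl))) =
    Eq.symmetric _ (Eq.map (Step-map [ inj₁ , inj₂ ∘ inj₁ ]′)
      (simplification⊆Conversion ([ inj₁ ∘ StepR▷⇒Step , inj₂ ]′ tu))) ◅◅
    pair⇒Conversion (inj₂ (inj₂ (refl , refl)))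
  ⊢ʳ-sound (collapse _ _) (inj₂ r) = pair⇒Conversion (inj₂ (inj₁ r))

  Decreasing : ES → Set
  Decreasing R = ∀ {l r} → R l r → l > r

  reduction⊆> : ∀ {E R} → Decreasing R → ∀ {s t} → Step (E ^> ∪ R) s t → s > t
  reduction⊆> R⊆> = >-Step λ { (inj₁ st) → ^>⊆> st ; (inj₂ st) → R⊆> st }

  ⊢ʳ-decreasing : ∀ {A B} → A ⊢ʳ B → Decreasing (proj₂ A) → Decreasing (proj₂ B)
  ⊢ʳ-decreasing (deduce _ _)      R⊆> r                    = R⊆> r
  ⊢ʳ-decreasing (orientˡ _ _)     R⊆> (inj₁ r)             = R⊆> r
  ⊢ʳ-decreasing (orientˡ _ s>t)   R⊆> (inj₂ (refl , refl)) = s>t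
  ⊢ʳ-decreasing (orientʳ _ _)     R⊆> (inj₁ r)             = R⊆> r
  ⊢ʳ-decreasing (orientʳ _ t>s)   R⊆> (inj₂ (refl , refl)) = t>s
  ⊢ʳ-decreasing (delete _)        R⊆> r                    = R⊆> r
  ⊢ʳ-decreasing (compose _ _)     R⊆> (inj₁ r)             = R⊆> (inj₁ r)
  ⊢ʳ-decreasing (compose _ tu)    R⊆> (inj₂ (refl , refl)) =
    O.trans (R⊆> (inj₂ (refl , refl))) (reduction⊆> (R⊆> ∘ inj₁) tu)
  ⊢ʳ-decreasing (simplifyˡ _ _)   R⊆> r                    = R⊆> r
  ⊢ʳ-decreasing (simplifyʳ _ _)   R⊆> r                    = R⊆> r
  ⊢ʳ-decreasing (collapse _ _)    R⊆> r                    = R⊆> (inj₁ r)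

  -- Fates from single inferences.

  module _ {E∞ R∞ Rω : ES} (R∞⊆> : Decreasing R∞) where

    open Fates E∞ R∞ Rω

    module _ {E R : ES} (E⊆ : E ⇒ E∞) (R⊆ : R ⇒ R∞) where

      StepE▷⇒Reduct▷ : ∀ {s u} → StepE▷ E s u → Reduct▷ s u
      StepE▷⇒Reduct▷ (step {l} {r} lr C σ lσ>rσ s▷l) =
        reduct l r (inj₂ ([ inj₁ ∘ E⊆ , inj₂ ∘ E⊆ ]′ lr)) (inst C σ refl refl)
               (closedContext C lσ>rσ) s▷l

      StepR▷⇒Reduct▷ : ∀ {s u} → StepR▷ R s u → Reduct▷ s u
      StepR▷⇒Reduct▷ (step {l} {r} lr C σ s▷l) =
        reduct l r (inj₁ (R⊆ lr)) i (>-Inst (R∞⊆> (R⊆ lr)) i) s▷l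
        where i = inst C σ refl refl

      simplification⇒Reduct▷ : ∀ {s u} → Step R s u ⊎ StepE▷ E s u → Step R∞ s u ⊎ Reduct▷ s u
      simplification⇒Reduct▷ = [ inj₁ ∘ Step-map R⊆ , inj₂ ∘ StepE▷⇒Reduct▷ ]′

      reduction⇒Reduct : ∀ {s u} → Step (E ^> ∪ R) s u → Reduct s u
      reduction⇒Reduct (step (inj₁ (l , r , τ , lr , refl , refl , l>r)) C σ) =
        reduct l r (inj₂ ([ inj₁ ∘ E⊆ , inj₂ ∘ E⊆ ]′ lr)) (Inst-closed C σ (inst □ τ refl refl))
               (closedContext C (closedSubst σ l>r))
      reduction⇒Reduct (step {l} {r} (inj₂ lr) C σ) =
        reduct l r (inj₁ (R⊆ lr)) i (>-Inst (R∞⊆> (R⊆ lr)) i)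
        where i = inst C σ refl refl

    -- The inference that takes a rule out is itself its fate. The inclusions place the pairs used
    -- in the old stage, and those added in the new one, into `E∞` and `R∞`.
    ⊢ʳ-fateR : ∀ {E R E′ R′ l r} → (E , R) ⊢ʳ (E′ , R′) → E ⇒ E∞ → R ⇒ R∞ → E′ ⇒ E∞ → R′ ⇒ R∞ →
               R l r → R′ l r ⊎ FateR l r
    ⊢ʳ-fateR (deduce _ _)     E⊆ R⊆ E′⊆ R′⊆ r = inj₁ r
    ⊢ʳ-fateR (orientˡ _ _)    E⊆ R⊆ E′⊆ R′⊆ r = inj₁ (inj₁ r)
    ⊢ʳ-fateR (orientʳ _ _)    E⊆ R⊆ E′⊆ R′⊆ r = inj₁ (inj₁ r)
    ⊢ʳ-fateR (delete _)       E⊆ R⊆ E′⊆ R′⊆ r = inj₁ r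
    ⊢ʳ-fateR (simplifyˡ _ _)  E⊆ R⊆ E′⊆ R′⊆ r = inj₁ r
    ⊢ʳ-fateR (simplifyʳ _ _)  E⊆ R⊆ E′⊆ R′⊆ r = inj₁ r
    ⊢ʳ-fateR (compose _ _)    E⊆ R⊆ E′⊆ R′⊆ (inj₁ r) = inj₁ (inj₁ r)
    ⊢ʳ-fateR (compose _ tu)   E⊆ R⊆ E′⊆ R′⊆ (inj₂ (refl , refl)) =
      inj₂ (composed (R′⊆ (inj₂ (refl , refl))) (reduction⇒Reduct E⊆ (R⊆ ∘ inj₁) tu))
    ⊢ʳ-fateR (collapse _ _)   E⊆ R⊆ E′⊆ R′⊆ (inj₁ r) = inj₁ r
    ⊢ʳ-fateR (collapse _ tu)  E⊆ R⊆ E′⊆ R′⊆ (inj₂ (refl , refl)) =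
      inj₂ (collapsed (inj₁ (E′⊆ (inj₂ (refl , refl))))
                      ([ StepR▷⇒Reduct▷ E⊆ (R⊆ ∘ inj₁) , StepE▷⇒Reduct▷ E⊆ (R⊆ ∘ inj₁) ]′ tu))

    ⊢ʳ-fateE : ∀ {E R E′ R′ s t} → (E , R) ⊢ʳ (E′ , R′) → E ⇒ E∞ → R ⇒ R∞ → E′ ⇒ E∞ → R′ ⇒ R∞ →
               E s t → E′ s t ⊎ FateE s t
    ⊢ʳ-fateE (deduce _ _)     E⊆ R⊆ E′⊆ R′⊆ e = inj₁ (inj₁ e)
    ⊢ʳ-fateE (compose _ _)    E⊆ R⊆ E′⊆ R′⊆ e = inj₁ e
    ⊢ʳ-fateE (collapse _ _)   E⊆ R⊆ E′⊆ R′⊆ e = inj₁ (inj₁ e)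
    ⊢ʳ-fateE (orientˡ _ _)    E⊆ R⊆ E′⊆ R′⊆ (inj₁ e) = inj₁ e
    ⊢ʳ-fateE (orientˡ _ _)    E⊆ R⊆ E′⊆ R′⊆ (inj₂ (refl , refl)) =
      inj₂ (orientedˡ (R′⊆ (inj₂ (refl , refl))))
    ⊢ʳ-fateE (orientʳ _ _)    E⊆ R⊆ E′⊆ R′⊆ (inj₁ e) = inj₁ e
    ⊢ʳ-fateE (orientʳ _ _)    E⊆ R⊆ E′⊆ R′⊆ (inj₂ (refl , refl)) =
      inj₂ (orientedʳ (R′⊆ (inj₂ (refl , refl))))
    ⊢ʳ-fateE (delete _)       E⊆ R⊆ E′⊆ R′⊆ (inj₁ e) = inj₁ e
    ⊢ʳ-fateE (delete _)       E⊆ R⊆ E′⊆ R′⊆ (inj₂ (refl , refl)) = inj₂ (trivial refl)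
    ⊢ʳ-fateE (simplifyˡ _ _)  E⊆ R⊆ E′⊆ R′⊆ (inj₁ e) = inj₁ (inj₁ e)
    ⊢ʳ-fateE (simplifyˡ _ su) E⊆ R⊆ E′⊆ R′⊆ (inj₂ (refl , refl)) =
      inj₂ (simplifiedˡ (inj₁ (E′⊆ (inj₂ (refl , refl)))) (simplification⇒Reduct▷ (E⊆ ∘ inj₁) R⊆ su))
    ⊢ʳ-fateE (simplifyʳ _ _)  E⊆ R⊆ E′⊆ R′⊆ (inj₁ e) = inj₁ (inj₁ e)
    ⊢ʳ-fateE (simplifyʳ _ tu) E⊆ R⊆ E′⊆ R′⊆ (inj₂ (refl , refl)) =
      inj₂ (simplifiedʳ (inj₁ (E′⊆ (inj₂ (refl , refl)))) (simplification⇒Reduct▷ (E⊆ ∘ inj₁) R⊆ tu))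

  -- If no stage removes the pair, it stays from stage `i` on. Any removal determines a fate, so `j`
  -- is not tied to `i`.
  persistent-or-removed : ∀ (X : ℕ → ES) {i s t} → X i s t →
                          (X ω) s t ⊎ ∃[ j ] X j s t × ¬ X (suc j) s t
  persistent-or-removed X {i} {s} {t} Xi with em {∃[ j ] X j s t × ¬ X (suc j) s t}
  ... | yes removed = inj₂ removed
  ... | no ¬removed = inj₁ (i , λ j i≤j → stays (ℕ.≤⇒≤′ i≤j))
    where
    stays : ∀ {j} → i ≤′ j → X j s t
    stays ≤′-refl             = Xi
    stays (≤′-step {j} i≤′j) with em {X (suc j) s t}
    ... | yes Xj+1 = Xj+1
    ... | no ¬Xj+1 = contradiction (j , stays i≤′j , ¬Xj+1) ¬removed

  -- The fair run.

  module Run (inf : Infinite V) (E R : ℕ → ES)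
             (run : ∀ i → (E i , R i) ⊢ (E (suc i) , R (suc i)))
             (R₀-empty : Empty (R 0)) (fair : Fair E R) (Eω-empty : Empty (E ω)) where

    R-decreasing : ∀ i → Decreasing (R i)
    R-decreasing zero    r = contradiction r R₀-empty
    R-decreasing (suc i) r with _ , _ , _ , _ , _ , (_ , R⇐) , inference , _ , (_ , R⇐′) ← run i =
      ⊢ʳ-decreasing inference (R-decreasing i ∘ R⇐) (R⇐′ r)

    sound : ∀ i → E i ∪ R i ⇒ Conversion (E 0)
    sound zero    (inj₁ e) = pair⇒Conversion e
    sound zero    (inj₂ r) = contradiction r R₀-empty
    sound (suc i) p
      with _ , _ , _ , _ , (_ , E⇐) , (_ , R⇐) , inference , (_ , E⇐′) , (_ , R⇐′) ← run i =
      ⊆Conversion⇒Conversion⊆ (sound i ∘ [ inj₁ ∘ E⇐ , inj₂ ∘ R⇐ ]′)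
        (⊢ʳ-sound inference ([ inj₁ ∘ E⇐′ , inj₂ ∘ R⇐′ ]′ p))

    R∞⊆> : Decreasing (R ∞)
    R∞⊆> (i , r) = R-decreasing i r

    Rω⊆R∞ : (R ω) ⇒ (R ∞)
    Rω⊆R∞ (i , r) = i , r i ℕ.≤-refl

    Rω⊆> : Decreasing (R ω)
    Rω⊆> = R∞⊆> ∘ Rω⊆R∞

    open Fates (E ∞) (R ∞) (R ω)

    fateR : ∀ {l r} → (R ∞) l r → FateR l r
    fateR (i , r) with persistent-or-removed R r
    ... | inj₁ rω = persists rω
    ... | inj₂ (j , rj , ¬rj+1)
      with _ , _ , _ , _ , (_ , E⇐) , (R⇒ , R⇐) , inference , (E⇒′ , _) , (R⇒′ , _) ← run j
      with ⊢ʳ-fateR R∞⊆> inference (λ e → j , E⇐ e) (λ r → j , R⇐ r)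
                    (λ e → suc j , E⇒′ e) (λ r → suc j , R⇒′ r) (R⇒ rj)
    ...   | inj₁ r′   = contradiction (R⇒′ r′) ¬rj+1
    ...   | inj₂ fate = fate

    fateE∞ : ∀ {s t} → (E ∞) s t → FateE s t
    fateE∞ (i , e) with persistent-or-removed E e
    ... | inj₁ eω = contradiction eω Eω-empty
    ... | inj₂ (j , ej , ¬ej+1)
      with _ , _ , _ , _ , (E⇒ , E⇐) , (_ , R⇐) , inference , (E⇒′ , _) , (R⇒′ , _) ← run j
      with ⊢ʳ-fateE R∞⊆> inference (λ e → j , E⇐ e) (λ r → j , R⇐ r)
                    (λ e → suc j , E⇒′ e) (λ r → suc j , R⇒′ r) (E⇒ ej)
    ...   | inj₁ e′   = contradiction (E⇒′ e′) ¬ej+1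
    ...   | inj₂ fate = fate

    fateE : ∀ {s t} → ((E ∞) ±) s t → FateE s t
    fateE (inj₁ e) = fateE∞ e
    fateE (inj₂ e) = FateE-sym (fateE∞ e)

    E∞-connected : ∀ (P : Term → Set) → (∀ {s t} → P s → s > t → P t) →
                   ∀ {s t} → P s → P t → Step (E ∞) s t → ConversionIn P (R ω) s t
    E∞-connected = Persistence.E∞-≃ R∞⊆> fateR fateE

    Y : ES
    Y = E ω ∪ R ω

    -- There are no persistent equations, and an ordered instance of a rule read from right to left
    -- contradicts the decrease of that rule.
    Y^>⊆Rω : Step (Y ^>) ⇒ Step (R ω)
    Y^>⊆Rω (step (l , r , τ , inj₁ (inj₁ e) , refl , refl , _) C σ) = contradiction e Eω-empty
    Y^>⊆Rω (step (l , r , τ , inj₁ (inj₂ lr) , refl , refl , _) C σ) = Step-closed C σ (step lr □ τ)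
    Y^>⊆Rω (step (l , r , τ , inj₂ (inj₁ e) , refl , refl , _) C σ) = contradiction e Eω-empty
    Y^>⊆Rω (step (l , r , τ , inj₂ (inj₂ rl) , refl , refl , l>r) C σ) =
      contradiction (closedSubst τ (Rω⊆> rl)) (>-asym l>r)

    S⊆Rω : (E ω) ^> ∪ R ω ⇒ R ω
    S⊆Rω (inj₁ (_ , _ , _ , e , _)) = [ (λ e → contradiction e Eω-empty) ,
                                        (λ e → contradiction e Eω-empty) ]′ e
    S⊆Rω (inj₂ r) = r

    -- By fairness the pair is joinable, and joining steps only descend, or it is an `E ∞`-step,
    -- which becomes a conversion below `s` by taking for `P` the terms below `s`.
    pcp-connected : ∀ {t u} → PCP Y t u → ∀ δ {s} → s > (t · δ) → s > (u · δ) →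
                    ConversionIn (s >_) (R ω) (t · δ) (u · δ)
    pcp-connected cp δ {s} s>t s>u with fair cp
    ... | inj₁ (w , tw , uw) =
      Joinable⇒ConversionIn Rω⊆> O.trans s>t s>u (w · δ , instantiated tw , instantiated uw)
      where
      instantiated : ∀ {s t} → Star (Step ((E ω) ^> ∪ R ω)) s t → Star (Step (R ω)) (s · δ) (t · δ)
      instantiated = Star.gmap (_· δ) (Step-closed □ δ ∘ Step-map S⊆Rω)
    ... | inj₂ (fwd tu) = E∞-connected (s >_) O.trans s>t s>u (Step-closed □ δ tu)
    ... | inj₂ (bwd ut) = Eq.symmetric _ (E∞-connected (s >_) O.trans s>u s>t (Step-closed □ δ ut))

    completePresentation : IsCompletePresentation (R ω) (E 0)
    completePresentation = record
      { complete = record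
          { isTRS       = ⊆>⇒isTRS Rω⊆>
          ; terminating = ⊆>⇒terminating Rω⊆>
          ; confluent   = connected⇒confluent Rω⊆> peak-connected _
          }
      ; sameConversion =
          ⊆Conversion⇒Conversion⊆ (λ (i , r) → sound i (inj₂ (r i ℕ.≤-refl))) ,
          -- Here `P` holds of all terms, and each step of `E 0` is a step of `E ∞`.
          Eq.fold (Eq.isEquivalence _) (λ st → Eq.map proj₁ (E∞-connected (λ _ → ⊤) _ tt tt
            (Step-map (0 ,_) st)))
      }
      where open CriticalPeaks inf Rω⊆> inj₂ Y^>⊆Rω pcp-connected

theorem7p17 : ExcludedMiddle 0ℓ →
    (𝓕 : Signature) (V : Set) → Infinite V →
    let open Rewriting 𝓕 V in
    (_>_ : Rel Term 0ℓ) → IsReductionOrder _>_ → GroundTotal _>_ →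
    let open OrderedCompletion _>_ in
    (E R : ℕ → ES) →
    (∀ i → (E i , R i) ⊢ (E (suc i) , R (suc i))) →
    Empty (R 0) →
    Fair E R →
    Empty (E ω) →
    IsCompletePresentation (R ω) (E 0)
theorem7p17 em 𝓕 V inf _>_ reductionOrder _ E R run R₀-empty fair Eω-empty =
  completePresentation
  where open Order em 𝓕 V _>_ reductionOrder
        open Run inf E R run R₀-empty fair Eω-empty
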